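{- There is a constant $c>0$ such that for all sufficiently large $n$, the natural logarithm of the number of designs $S(3,\{4,6\},2n)$ on a fixed $2n$-element set is greater than $c\,n^3\ln n$.
   Context: A design $S(3,\{4,6\},v)$ on a $v$-element set $X$ is a set of subsets of $X$ (blocks), each of size $4$ or $6$, such that every $3$-element subset of $X$ is contained in exactly one block. -}

module Defs where

open import Data.Bool using (Bool; true; false; _∧_; _∨_; not)
open import Data.Nat using (ℕ; zero; suc; _≡ᵇ_)
open import Data.List using (List; []; _∷_; [_]; _++_; map; length; filterᵇ)
open import Data.Bool.ListAction using (and)
open import Data.Vec using (Vec; []; _∷_)
open import Data.Fin.Subset using (Subset; ∣_∣; inside; outside)
open import Data.Fin.Subset.Properties using (_⊆?_)
open import Relation.Nullary.Decidable using (⌊_⌋)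

allSubsets : (v : ℕ) → List (Subset v)
allSubsets zero    = [ [] ]
allSubsets (suc v) = map (outside ∷_) (allSubsets v) ++ map (inside ∷_) (allSubsets v)

-- All sublists of a list; for a duplicate-free list these are exactly its subsets.
sublists : {A : Set} → List A → List (List A)
sublists []       = [ [] ]
sublists (x ∷ xs) = sublists xs ++ map (x ∷_) (sublists xs)

-- A family of blocks (sublist of allSubsets v, i.e. a set of subsets of Fin v)
-- is an S(3,{4,6},v) design iff every block has size 4 or 6 and every
-- 3-element subset T of Fin v lies in exactly one block.
isDesign : (v : ℕ) → List (Subset v) → Bool
isDesign v B =
  and (map (λ b → (∣ b ∣ ≡ᵇ 4) ∨ (∣ b ∣ ≡ᵇ 6)) B)
  ∧ and (map (λ T → not (∣ T ∣ ≡ᵇ 3) ∨ (length (filterᵇ (λ b → ⌊ T ⊆? b ⌋) B) ≡ᵇ 1))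
        (allSubsets v))

numDesigns : ℕ → ℕ
numDesigns v = length (filterᵇ (isDesign v) (sublists (allSubsets v)))

-- Hanani's recursions u ↦ 2u and u ↦ 2u − 2 produce an S(3,{4,6},v) for every even v ≥ 8 from
-- designs on 8, 10 and 12 points. Both replace a 4-block by the eight even-weight words over it, so a
-- transversal design {x₀, y₁, z₂, w₃ | x + y + z + w = 0} over ℤ₂ᴷ is turned into one over ℤ₂ᴷ⁺¹,
-- provided that no deleted point lies on it; hence the design on v points contains one
-- with 12·2ᴷ ≥ v. It may be exchanged for any Latin cube of order m = 2ᴷ. There are m^(c m³)
-- Latin cubes: in the cube x + y + z one can flip pairwise disjoint subcubes of order 2, one at each of
-- (m/32)³ cells, where at every cell at most 7m/32 of the m/2 directions are excluded by
-- the subcubes chosen before.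

module Submission where

open import Defs
open import Data.Bool using (Bool; true; false; T; not; _xor_; _∧_; _∨_)
open import Data.Bool.ListAction using (and)
import Data.Bool.Properties as Bool
open import Data.Empty using (⊥; ⊥-elim-irr)
open import Data.Fin using (Fin; zero; suc; toℕ; punchIn; punchOut)
import Data.Fin as Fin
open import Data.Fin.Patterns
import Data.Fin.Properties as Fin
open import Data.Fin.Subset as Subset using (Subset; ∣_∣; inside; outside)
  renaming (_∈_ to _∈ˢ_; _∉_ to _∉ˢ_; _⊆_ to _⊆ˢ_)
import Data.Fin.Subset.Properties as Subset
open import Data.List using (List; []; _∷_; _++_; map; length; allFin; filter; filterᵇ; concatMap;
  cartesianProduct; cartesianProductWith)
open import Data.List.Membership.DecPropositional using () renaming (_∈?_ to mem?)
open import Data.List.Membership.Propositional using (_∈_; _∉_; find; lose)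
import Data.List.Membership.Propositional.Properties as ∈
import Data.List.Properties as List
open import Data.List.Relation.Unary.All as All using (All; []; _∷_)
import Data.List.Relation.Unary.All.Properties as All
open import Data.List.Relation.Unary.AllPairs using (AllPairs; []; _∷_)
open import Data.List.Relation.Unary.Any as Any using (Any; here; there)
open import Data.List.Relation.Unary.Unique.Propositional using (Unique)
import Data.List.Relation.Unary.Unique.Propositional.Properties as Unique
open import Data.Nat using (ℕ; zero; suc; _+_; _*_; _^_; _≤_; _<_; s≤s; z≤n; _≡ᵇ_; NonZero; >-nonZero)
open import Data.Nat.DivMod using (_mod_)
open import Data.Nat.Induction using (<-rec)
import Data.Nat.Properties as ℕ
open import Data.Product using (Σ; ∃; ∃₂; _×_; _,_; proj₁; proj₂; map₁)
import Data.Product.Properties as Product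
open import Data.Sum as Sum using (_⊎_; inj₁; inj₂)
open import Data.Unit using (⊤; tt)
open import Data.Vec using (Vec; []; _∷_; here; there; lookup; replicate; zipWith; _[_]≔_)
import Data.Vec.Properties as Vec
open import Function using (_∘_; id)
open import Function.Bundles using (Equivalence)
open import Relation.Binary.Definitions using (DecidableEquality; tri<; tri≈; tri>)
open import Relation.Binary.PropositionalEquality
open import Relation.Nullary using (¬_; Dec; yes; no; contradiction)
open import Relation.Nullary.Decidable
  using (map′; _×-dec_; _→-dec_; _⊎-dec_; ¬?; ⌊_⌋; True; from-yes; toWitness; fromWitness)
open import Relation.Unary using (Decidable)

-- On a subcube p + {0, v}³ the sum x + y + z takes only two values, s and s + v, by the parity of
-- the vertex. Adding v on the whole subcube exchanges them. A line of the cube meets the subcube in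
-- no cell or in two, so the cube stays Latin. Flips at different cells interact only through
-- disjointness. If subcubes at p and q with directions v and w share a vertex, then q is p moved by
-- one displacement d = v + w in some of the three coordinates. Hence the excluded directions number
-- at most seven times the possible displacements, and not in proportion to the number of cells;
-- confining the cells to a small subgroup confines d as well. The exchange inside a design works
-- because the cells of every Latin cube cover the same triples of points, each once: those from
-- three different groups. Conversely, the block through x₀, y₁, z₂ reveals the symbol as its fourth
-- point, so different cubes give different designs. Logarithms are avoided by taking c = p / q: the
-- claim becomes n^(p n³) < D^q for the number D of designs.

data Kind : Set where
  four six : Kind

derivedSize : Kind → ℕ
derivedSize four = 3
derivedSize six  = 5

size : Kind → ℕ
size κ = suc (derivedSize κ)

Distinct : {X : Set} → X → X → X → Set
Distinct x y z = x ≢ y × x ≢ z × y ≢ z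

Transversal : {X : Set} → X × Bool → X × Bool → X × Bool → Set
Transversal p q r = Distinct (proj₁ p) (proj₁ q) (proj₁ r)

infix 4 _∈ᶠ_
_∈ᶠ_ : {X : Set} {n : ℕ} → X → (Fin n → X) → Set
x ∈ᶠ g = ∃ λ i → g i ≡ x

Through : {X : Set} {n : ℕ} → X → X → X → (Fin n → X) → Set
Through x y z g = x ∈ᶠ g × y ∈ᶠ g × z ∈ᶠ g

Injection : {A B : Set} → (A → B) → Set
Injection f = ∀ {x y} → f x ≡ f y → x ≡ y

-- A block carries a labelling of its points, because replacing a block of
-- size 6 by a configuration on its inflation depends on the labelling.
record Design (X : Set) (T : X → X → X → Set) : Set₁ where
  field
    Block   : Kind → Set
    pts     : ∀ {κ} → Block κ → Fin (size κ) → X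
    pts-inj : ∀ {κ} (b : Block κ) → Injection (pts b)
    cover   : ∀ {x y z} → T x y z → ∃₂ λ κ (b : Block κ) → Through x y z (pts b)
    unique  : ∀ {x y z κ κ′} (b : Block κ) (b′ : Block κ′) → T x y z →
              Through x y z (pts b) → Through x y z (pts b′) →
              _≡_ {A = Σ Kind Block} (κ , b) (κ′ , b′)

-- Exhaustive verification of small configurations

Listing : Set → Set
Listing A = ∃ λ (xs : List A) → ∀ x → x ∈ xs

list-⊥ : Listing ⊥
list-⊥ = [] , λ ()

list-⊤ : Listing ⊤
list-⊤ = tt ∷ [] , λ _ → here refl

list-Bool : Listing Bool
list-Bool = false ∷ true ∷ [] , λ { false → here refl ; true → there (here refl) }

list-Fin : ∀ {n} → Listing (Fin n)
list-Fin = allFin _ , ∈.∈-allFin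

list-× : {A B : Set} → Listing A → Listing B → Listing (A × B)
list-× (xs , ∈xs) (ys , ∈ys) = cartesianProduct xs ys , λ (x , y) → ∈.∈-cartesianProduct⁺ (∈xs x) (∈ys y)

-- The three membership conditions are imposed one after another, on ever shorter lists of
-- blocks: this keeps the exhaustive check cheap.
module Check (n : ℕ) {T : Fin n × Bool → Fin n × Bool → Fin n × Bool → Set}
  (T? : ∀ x y z → Dec (T x y z))
  (Block : Kind → Set) (list-Block : ∀ κ → Listing (Block κ))
  (pts : ∀ {κ} → Block κ → Fin (size κ) → Fin n × Bool) where

  Point : Set
  Point = Fin n × Bool

  points : Listing Point
  points = list-× list-Fin list-Bool

  _≟ᴾ_ : DecidableEquality Point
  _≟ᴾ_ = Product.≡-dec Fin._≟_ Bool._≟_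

  Labelled : Set
  Labelled = Σ Kind Block

  blocks : Listing Labelled
  blocks = map (four ,_) (proj₁ (list-Block four)) ++ map (six ,_) (proj₁ (list-Block six)) , λ where
    (four , b) → ∈.∈-++⁺ˡ (∈.∈-map⁺ _ (proj₂ (list-Block four) b))
    (six , b)  → ∈.∈-++⁺ʳ (map (four ,_) (proj₁ (list-Block four))) (∈.∈-map⁺ _ (proj₂ (list-Block six) b))

  On : Point → Labelled → Set
  On x (κ , b) = x ∈ᶠ pts b

  on? : ∀ x → Decidable (On x)
  on? x (κ , b) = Fin.any? λ i → pts b i ≟ᴾ x

  on : Point → List Labelled → List Labelled
  on x = filter (on? x)

  Single : List Labelled → Set
  Single bs = ∃ λ b → bs ≡ b ∷ []

  single? : Decidable Single
  single? []           = no λ ()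
  single? (b ∷ [])     = yes (b , refl)
  single? (_ ∷ _ ∷ _)  = no λ ()

  Injective : Set
  Injective = All (λ (κ , b) → ∀ i j → pts b i ≡ pts b j → i ≡ j) (proj₁ blocks)

  injective? : Dec Injective
  injective? = All.all? (λ (κ , b) → Fin.all? λ i → Fin.all? λ j → (pts b i ≟ᴾ pts b j) →-dec (i Fin.≟ j)) (proj₁ blocks)

  CoveredOnce : Set
  CoveredOnce = All (λ x → All (λ y → All (λ z →
    T x y z → Single (on z (on y (on x (proj₁ blocks))))) (proj₁ points)) (proj₁ points)) (proj₁ points)

  coveredOnce? : Dec CoveredOnce
  coveredOnce? = All.all? (λ x → checkʸ x (on x (proj₁ blocks))) (proj₁ points)
    where
    checkᶻ : ∀ x y bs → Dec (All (λ z → T x y z → Single (on z bs)) (proj₁ points))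
    checkᶻ x y bs = All.all? (λ z → T? x y z →-dec single? (on z bs)) (proj₁ points)
    checkʸ : ∀ x bs → Dec (All (λ y → All (λ z → T x y z → Single (on z (on y bs))) (proj₁ points)) (proj₁ points))
    checkʸ x bs = All.all? (λ y → checkᶻ x y (on y bs)) (proj₁ points)

  design : Injective → CoveredOnce → Design Point T
  design inj once = record
    { Block   = Block
    ; pts     = pts
    ; pts-inj = λ {κ} b → All.lookup inj (proj₂ blocks (κ , b)) _ _
    ; cover   = cover
    ; unique  = λ b b′ t th th′ → unique (single _ _ _ t) th th′
    }
    where
    single : ∀ x y z → T x y z → Single (on z (on y (on x (proj₁ blocks))))
    single x y z = All.lookup (All.lookup (All.lookup once (proj₂ points x)) (proj₂ points y)) (proj₂ points z)
    cover : ∀ {x y z} → T x y z → ∃₂ λ κ (b : Block κ) → Through x y z (pts b)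
    cover {x} {y} {z} t with single x y z t
    ... | (κ , b) , e =
      let b∈ᵧ , z∈ = ∈.∈-filter⁻ (on? z) (subst ((κ , b) ∈_) (sym e) (here refl))
          b∈ₓ , y∈ = ∈.∈-filter⁻ (on? y) b∈ᵧ
          _   , x∈ = ∈.∈-filter⁻ (on? x) {xs = proj₁ blocks} b∈ₓ
      in κ , b , x∈ , y∈ , z∈
    listed : ∀ {x y z} (b : Labelled) → Through x y z (pts (proj₂ b)) → b ∈ on z (on y (on x (proj₁ blocks)))
    listed {x} {y} {z} b (x∈ , y∈ , z∈) =
      ∈.∈-filter⁺ (on? z) (∈.∈-filter⁺ (on? y) (∈.∈-filter⁺ (on? x) (proj₂ blocks b) x∈) y∈) z∈
    unique : ∀ {x y z} {b b′ : Labelled} → Single (on z (on y (on x (proj₁ blocks)))) →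
      Through x y z (pts (proj₂ b)) → Through x y z (pts (proj₂ b′)) → b ≡ b′
    unique {b = b} {b′} (_ , e) th th′ with subst (b ∈_) e (listed b th) | subst (b′ ∈_) e (listed b′ th′)
    ... | here refl | here refl = refl

distinct? : {X : Set} → DecidableEquality X → ∀ x y z → Dec (Distinct {X} x y z)
distinct? _≟_ x y z = ¬? (x ≟ y) ×-dec ¬? (x ≟ z) ×-dec ¬? (y ≟ z)

transversal? : ∀ {n} (p q r : Fin n × Bool) → Dec (Transversal p q r)
transversal? p q r = distinct? Fin._≟_ (proj₁ p) (proj₁ q) (proj₁ r)

-- Doubling and puncturing

evenWord : Bool × Bool × Bool → Fin 4 → Bool
evenWord (a , b , c) 0F = a
evenWord (a , b , c) 1F = b
evenWord (a , b , c) 2F = c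
evenWord (a , b , c) 3F = a xor (b xor c)

-- The 1-factorization of K₆ on ℤ₅ ∪ {5}. If xy and zw are different edges of one factor,
-- then {x₀, y₀, z₁, w₁} is a block; these blocks and the two constant words cover the
-- transversal triples of six pairs.
factor : Vec (Vec (Fin 6 × Fin 6) 3) 5
factor = ((5F , 0F) ∷ (1F , 4F) ∷ (2F , 3F) ∷ [])
       ∷ ((5F , 1F) ∷ (2F , 0F) ∷ (3F , 4F) ∷ [])
       ∷ ((5F , 2F) ∷ (3F , 1F) ∷ (4F , 0F) ∷ [])
       ∷ ((5F , 3F) ∷ (4F , 2F) ∷ (0F , 1F) ∷ [])
       ∷ ((5F , 4F) ∷ (0F , 3F) ∷ (1F , 2F) ∷ [])
       ∷ []

-- The first `Kind` is that of the block being inflated, the second that of a new block. For six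
-- pairs, 2 blocks of size 6 and 30 of size 4 account for 2 · 20 + 30 · 4 = 160 transversal triples,
-- which is all of them.
LiftBlock : Kind → Kind → Set
LiftBlock four four = Bool × Bool × Bool
LiftBlock four six  = ⊥
LiftBlock six  four = Fin 5 × Fin 3 × Fin 2
LiftBlock six  six  = Bool

liftPts : ∀ κ {κ′} → LiftBlock κ κ′ → Fin (size κ′) → Fin (size κ) × Bool
liftPts four {four} w i = i , evenWord w i
liftPts six  {six}  ε i = i , ε
liftPts six  {four} (f , e , e′) i = lookup
  ((proj₁ xy , false) ∷ (proj₂ xy , false) ∷ (proj₁ zw , true) ∷ (proj₂ zw , true) ∷ []) i
  where
  xy = lookup (lookup factor f) e
  -- `punchIn e` runs through the two edges of the factor other than `e`.
  zw = lookup (lookup factor f) (punchIn e e′)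

list-LiftBlock : ∀ κ κ′ → Listing (LiftBlock κ κ′)
list-LiftBlock four four = list-× list-Bool (list-× list-Bool list-Bool)
list-LiftBlock four six  = list-⊥
list-LiftBlock six  four = list-× list-Fin (list-× list-Fin list-Fin)
list-LiftBlock six  six  = list-Bool

module CheckLift (κ : Kind) = Check (size κ) transversal? (LiftBlock κ) (list-LiftBlock κ) (liftPts κ)

lift-injective : ∀ κ → CheckLift.Injective κ
lift-injective four = from-yes (CheckLift.injective? four)
lift-injective six  = from-yes (CheckLift.injective? six)

lift-coveredOnce : ∀ κ → CheckLift.CoveredOnce κ
lift-coveredOnce four = from-yes (CheckLift.coveredOnce? four)
lift-coveredOnce six  = from-yes (CheckLift.coveredOnce? six)

Lift : ∀ κ → Design (Fin (size κ) × Bool) Transversal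
Lift κ = CheckLift.design κ (lift-injective κ) (lift-coveredOnce κ)

-- This separates the inflated blocks from those containing whole fibres: all triples on an inflated
-- block are transversal.
lift-transversal : ∀ κ {κ′} (w : LiftBlock κ κ′) → Injection (proj₁ ∘ liftPts κ w)
lift-transversal four {four} w = id
lift-transversal six  {six}  w = id
lift-transversal six  {four} w = All.lookup
  (from-yes (All.all? (λ w → Fin.all? λ i → Fin.all? λ j →
      (proj₁ (liftPts six {four} w i) Fin.≟ proj₁ (liftPts six {four} w j)) →-dec (i Fin.≟ j))
    (proj₁ (list-LiftBlock six four))))
  (proj₂ (list-LiftBlock six four) w) _ _

FillBlock : Kind → Kind → Set
FillBlock four four = ⊥
FillBlock four six  = ⊤
FillBlock six  four = Fin 10 × Fin 3
FillBlock six  six  = ⊥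

-- Base blocks of a cyclic quadruple system on ℤ₁₀.
base : Vec (Vec ℕ 4) 3
base = (0 ∷ 1 ∷ 3 ∷ 4 ∷ []) ∷ (0 ∷ 1 ∷ 2 ∷ 6 ∷ []) ∷ (0 ∷ 2 ∷ 4 ∷ 7 ∷ []) ∷ []

isEven : ℕ → Bool
isEven zero    = true
isEven (suc n) = not (isEven n)

fillPts : ∀ κ {κ′} → FillBlock κ κ′ → Fin (size κ′) → Fin (derivedSize κ) × Bool
fillPts four {six}  _ i = lookup
  ((0F , false) ∷ (0F , true) ∷ (1F , false) ∷ (1F , true) ∷ (2F , false) ∷ (2F , true) ∷ []) i
-- The Chinese remainder theorem identifies ℤ₁₀ with ℤ₅ × ℤ₂. The sum `m` may exceed 9, but both
-- components depend only on its class modulo 10.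
fillPts six  {four} (t , e) i = m mod 5 , isEven m
  where m = toℕ t + lookup (lookup base e) i

list-FillBlock : ∀ κ κ′ → Listing (FillBlock κ κ′)
list-FillBlock four four = list-⊥
list-FillBlock four six  = list-⊤
list-FillBlock six  four = list-× list-Fin list-Fin
list-FillBlock six  six  = list-⊥

module CheckFill (κ : Kind) =
  Check (derivedSize κ) (distinct? (Product.≡-dec Fin._≟_ Bool._≟_)) (FillBlock κ) (list-FillBlock κ) (fillPts κ)

fill-injective : ∀ κ → CheckFill.Injective κ
fill-injective four = from-yes (CheckFill.injective? four)
fill-injective six  = from-yes (CheckFill.injective? six)

fill-coveredOnce : ∀ κ → CheckFill.CoveredOnce κ
fill-coveredOnce four = from-yes (CheckFill.coveredOnce? four)
fill-coveredOnce six  = from-yes (CheckFill.coveredOnce? six)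

Fill : ∀ κ → Design (Fin (derivedSize κ) × Bool) Distinct
Fill κ = CheckFill.design κ (fill-injective κ) (fill-coveredOnce κ)

module Inflate {n : ℕ} {T : Fin n × Bool → Fin n × Bool → Fin n × Bool → Set}
  (I : Design (Fin n × Bool) T) {X : Set} (g : Fin n → X) (g-inj : Injection g) where

  open Design I

  inflate : ∀ {κ} → Block κ → Fin (size κ) → X × Bool
  inflate w l = map₁ g (pts w l)

  inflate-inj : ∀ {κ} (w : Block κ) → Injection (inflate w)
  inflate-inj w e = pts-inj w
    (cong₂ _,_ (g-inj (cong proj₁ e)) (cong proj₂ e))

  inflate⁻ : ∀ {κ} {w : Block κ} {p} → p ∈ᶠ inflate w → ∃ λ c → g c ≡ proj₁ p × (c , proj₂ p) ∈ᶠ pts w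
  inflate⁻ {w = w} (l , refl) = proj₁ (pts w l) , refl , l , refl

  inflate⁺ : ∀ {κ} {w : Block κ} {c ε} → (c , ε) ∈ᶠ pts w → (g c , ε) ∈ᶠ inflate w
  inflate⁺ (l , refl) = l , refl

  inflate-cover : ∀ {c d e α β γ} → T (c , α) (d , β) (e , γ) →
    ∃₂ λ κ (w : Block κ) → Through (g c , α) (g d , β) (g e , γ) (inflate w)
  inflate-cover t = let κ , w , x∈ , y∈ , z∈ = cover t in κ , w , inflate⁺ x∈ , inflate⁺ y∈ , inflate⁺ z∈

  -- Injectivity of `g` reduces both incidences to the same three labelled points. The premise on
  -- preimages lets the lemma serve `Transversal` in the lifts and `Distinct` in the fillings.
  inflate-unique : ∀ {κ κ′ p q r} (w : Block κ) (w′ : Block κ′) →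
    (∀ {c d e} → g c ≡ proj₁ p → g d ≡ proj₁ q → g e ≡ proj₁ r →
      T (c , proj₂ p) (d , proj₂ q) (e , proj₂ r)) →
    Through p q r (inflate w) → Through p q r (inflate w′) →
    _≡_ {A = Σ Kind Block} (κ , w) (κ′ , w′)
  inflate-unique w w′ t (x∈ , y∈ , z∈) (x∈′ , y∈′ , z∈′)
    with inflate⁻ x∈ | inflate⁻ y∈ | inflate⁻ z∈ | inflate⁻ x∈′ | inflate⁻ y∈′ | inflate⁻ z∈′
  ... | c , gc , c∈ | d , gd , d∈ | e , ge , e∈ | c′ , gc′ , c∈′ | d′ , gd′ , d∈′ | e′ , ge′ , e∈′
    with refl ← g-inj (trans gc (sym gc′)) | refl ← g-inj (trans gd (sym gd′))
       | refl ← g-inj (trans ge (sym ge′)) = unique w w′ (t gc gd ge) (c∈ , d∈ , e∈) (c∈′ , d∈′ , e∈′)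

∈-base : ∀ {n κ} {T} {I : Design (Fin n × Bool) T} {X : Set} {g : Fin n → X} {w : Design.Block I κ} {p : X × Bool} →
  p ∈ᶠ (λ l → map₁ g (Design.pts I w l)) → proj₁ p ∈ᶠ g
∈-base {I = I} {w = w} (l , refl) = proj₁ (Design.pts I w l) , refl

through-base : ∀ {n κ} {T} {I : Design (Fin n × Bool) T} {X : Set} {g : Fin n → X} {w : Design.Block I κ}
  {p q r : X × Bool} → Through p q r (λ l → map₁ g (Design.pts I w l)) →
  Through (proj₁ p) (proj₁ q) (proj₁ r) g
through-base {I = I} {w = w} (x , y , z) =
  ∈-base {I = I} {w = w} x , ∈-base {I = I} {w = w} y , ∈-base {I = I} {w = w} z

-- A fibre has only two points, so two distinct ones leave no room for a third.
third≢ : {X : Set} {x y : X} {α β γ : Bool} → (x , α) ≢ (x , β) → (x , α) ≢ (y , γ) → (x , β) ≢ (y , γ) → x ≢ y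
third≢ {α = false} {false} αβ αγ βγ refl = αβ refl
third≢ {α = false} {true} {false} αβ αγ βγ refl = αγ refl
third≢ {α = false} {true} {true} αβ αγ βγ refl = βγ refl
third≢ {α = true} {false} {false} αβ αγ βγ refl = βγ refl
third≢ {α = true} {false} {true} αβ αγ βγ refl = αγ refl
third≢ {α = true} {true} αβ αγ βγ refl = αβ refl

module _ {X : Set} (D : Design X Distinct) where
  open Design D

  liftOf : ∀ {κ κ′} → Block κ → LiftBlock κ κ′ → Fin (size κ′) → X × Bool
  liftOf {κ} b = Inflate.inflate (Lift κ) (pts b) (pts-inj b)

  liftOf-transversal : ∀ {κ κ′ p q r} (b : Block κ) (w : LiftBlock κ κ′) → Distinct p q r →
    Through p q r (liftOf b w) → Transversal p q r
  liftOf-transversal {κ} b w (pq , pr , qr) ((i , refl) , (j , refl) , (l , refl)) =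
      pq ∘ cong (liftOf b w) ∘ lift-transversal κ w ∘ pts-inj b
    , pr ∘ cong (liftOf b w) ∘ lift-transversal κ w ∘ pts-inj b
    , qr ∘ cong (liftOf b w) ∘ lift-transversal κ w ∘ pts-inj b

  liftOf-cover : ∀ {κ} (b : Block κ) {p q r} → Transversal p q r →
    Through (proj₁ p) (proj₁ q) (proj₁ r) (pts b) →
    ∃₂ λ κ′ (w : LiftBlock κ κ′) → Through p q r (liftOf b w)
  liftOf-cover {κ} b (xy , xz , yz) ((i , refl) , (j , refl) , (l , refl)) =
    Inflate.inflate-cover (Lift κ) (pts b) (pts-inj b)
      (xy ∘ cong (pts b) , xz ∘ cong (pts b) , yz ∘ cong (pts b))

  LiftedBlock : Kind → Set
  LiftedBlock κ′ = ∃ λ κ → Block κ × LiftBlock κ κ′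

  -- Two stages: the projections of the triple, distinct by transversality, single out the old
  -- block; uniqueness in `Lift κ` then singles out the new block over it.
  liftOf-unique : ∀ {κ κ′ ι ι′ p q r} (b : Block κ) (w : LiftBlock κ ι) (b′ : Block κ′) (w′ : LiftBlock κ′ ι′) →
    Transversal p q r → Through p q r (liftOf b w) → Through p q r (liftOf b′ w′) →
    _≡_ {A = Σ Kind LiftedBlock} (ι , κ , b , w) (ι′ , κ′ , b′ , w′)
  liftOf-unique {κ} {κ′} b w b′ w′ t th th′
    with refl ← unique b b′ t (through-base {I = Lift κ} {w = w} th) (through-base {I = Lift κ′} {w = w′} th′)
    with refl ← Inflate.inflate-unique (Lift κ) (pts b) (pts-inj b) w w′
                  (λ { refl refl refl → let (xy , xz , yz) = t in
                       xy ∘ cong (pts b) , xz ∘ cong (pts b) , yz ∘ cong (pts b) }) th th′ = refl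

-- The blocks are the unions of two fibres of X × Bool → X and the inflations of the old blocks.
module Double {u : ℕ} (D : Design (Fin u) Distinct) where
  open Design D

  data Block₂ : Kind → Set where
    -- The order lets every pair of fibres occur once; its irrelevance makes blocks with equal
    -- indices equal.
    pair : (i j : Fin u) → .(i Fin.< j) → Block₂ four
    lift : ∀ {κ κ′} → Block κ → LiftBlock κ κ′ → Block₂ κ′

  side : Fin u → Fin u → Fin 4 → Fin u × Bool
  side i j 0F = i , false
  side i j 1F = i , true
  side i j 2F = j , false
  side i j 3F = j , true

  pts₂ : ∀ {κ} → Block₂ κ → Fin (size κ) → Fin u × Bool
  pts₂ (pair i j _) = side i j
  pts₂ (lift b w)   = liftOf D b w

  side-inj : ∀ {i j} → i ≢ j → Injection (side i j)
  side-inj i≢j {0F} {0F} e = refl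
  side-inj i≢j {0F} {2F} e = contradiction (cong proj₁ e) i≢j
  side-inj i≢j {0F} {3F} ()
  side-inj i≢j {1F} {1F} e = refl
  side-inj i≢j {1F} {3F} e = contradiction (cong proj₁ e) i≢j
  side-inj i≢j {2F} {0F} e = contradiction (sym (cong proj₁ e)) i≢j
  side-inj i≢j {2F} {2F} e = refl
  side-inj i≢j {2F} {3F} ()
  side-inj i≢j {3F} {1F} e = contradiction (sym (cong proj₁ e)) i≢j
  side-inj i≢j {3F} {3F} e = refl

  <⇒≢ : ∀ {i j : Fin u} → .(i Fin.< j) → i ≢ j
  <⇒≢ i<j refl = ⊥-elim-irr (Fin.<-irrefl refl i<j)

  pts₂-inj : ∀ {κ} (b : Block₂ κ) → Injection (pts₂ b)
  pts₂-inj (pair i j i<j)   = side-inj (<⇒≢ i<j)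
  pts₂-inj (lift {κ} b w) = Inflate.inflate-inj (Lift κ) (pts b) (pts-inj b) w

  pair-cover : ∀ x z → x ≢ z → Σ (Block₂ four) λ b → ∀ ε → (x , ε) ∈ᶠ pts₂ b × (z , ε) ∈ᶠ pts₂ b
  pair-cover x z x≢z with Fin.<-cmp x z
  ... | tri< x<z _ _ = pair x z x<z , λ { false → (0F , refl) , (2F , refl) ; true → (1F , refl) , (3F , refl) }
  ... | tri≈ _ x≡z _ = contradiction x≡z x≢z
  ... | tri> _ _ z<x = pair z x z<x , λ { false → (2F , refl) , (0F , refl) ; true → (3F , refl) , (1F , refl) }

  cover₂ : ∀ {p q r} → Distinct p q r → ∃₂ λ κ (b : Block₂ κ) → Through p q r (pts₂ b)
  cover₂ {x , α} {y , β} {z , γ} (pq , pr , qr) with x Fin.≟ y | x Fin.≟ z | y Fin.≟ z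
  ... | yes refl | _ | _ = let b , on = pair-cover x z (third≢ pq pr qr) in
        four , b , proj₁ (on α) , proj₁ (on β) , proj₂ (on γ)
  ... | no _ | yes refl | _ = let b , on = pair-cover x y (third≢ pr pq (qr ∘ sym)) in
        four , b , proj₁ (on α) , proj₂ (on β) , proj₁ (on γ)
  ... | no _ | no _ | yes refl = let b , on = pair-cover y x (third≢ qr (pq ∘ sym) (pr ∘ sym)) in
        four , b , proj₂ (on α) , proj₁ (on β) , proj₁ (on γ)
  ... | no xy | no xz | no yz =
        let κ , b , th = cover (xy , xz , yz)
            κ′ , w , th′ = liftOf-cover D b {_ , α} {_ , β} {_ , γ} (xy , xz , yz) th
        in κ′ , lift b w , th′

  private
    FirstIs : Fin u → Fin u × Bool → Fin u × Bool → Fin u × Bool → Set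
    FirstIs i p q r = proj₁ p ≡ i ⊎ proj₁ q ≡ i ⊎ proj₁ r ≡ i

  first : ∀ {i j p} → p ∈ᶠ side i j → proj₁ p ≡ i ⊎ proj₁ p ≡ j
  first (0F , refl) = inj₁ refl
  first (1F , refl) = inj₁ refl
  first (2F , refl) = inj₂ refl
  first (3F , refl) = inj₂ refl

  -- Three distinct points do not fit into one fibre. The triple therefore reveals the unordered
  -- pair of `i` and `j`, which gives uniqueness of the pair blocks.
  both : ∀ {i j p q r} → Distinct p q r → Through p q r (side i j) → FirstIs i p q r × FirstIs j p q r
  both {p = x , α} {y , β} {z , γ} (pq , pr , qr) (x∈ , y∈ , z∈) with first x∈ | first y∈ | first z∈
  ... | inj₁ refl | inj₁ refl | inj₁ refl = contradiction refl (third≢ pq pr qr)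
  ... | inj₁ refl | inj₁ refl | inj₂ refl = inj₁ refl , inj₂ (inj₂ refl)
  ... | inj₁ refl | inj₂ refl | _ = inj₁ refl , inj₂ (inj₁ refl)
  ... | inj₂ refl | inj₁ refl | _ = inj₂ (inj₁ refl) , inj₁ refl
  ... | inj₂ refl | inj₂ refl | inj₁ refl = inj₂ (inj₂ refl) , inj₁ refl
  ... | inj₂ refl | inj₂ refl | inj₂ refl = contradiction refl (third≢ pq pr qr)

  firstIs⇒∈ : ∀ {i i′ j′ p q r} → Through p q r (side i′ j′) → FirstIs i p q r → i ≡ i′ ⊎ i ≡ j′
  firstIs⇒∈ (x∈ , y∈ , z∈) (inj₁ refl) = first x∈
  firstIs⇒∈ (x∈ , y∈ , z∈) (inj₂ (inj₁ refl)) = first y∈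
  firstIs⇒∈ (x∈ , y∈ , z∈) (inj₂ (inj₂ refl)) = first z∈

  side-¬transversal : ∀ {i j p q r} → Through p q r (side i j) → ¬ Transversal p q r
  side-¬transversal (x∈ , y∈ , z∈) (xy , xz , yz) with first x∈ | first y∈ | first z∈
  ... | inj₁ refl | inj₁ refl | _ = xy refl
  ... | inj₁ refl | inj₂ refl | inj₁ refl = xz refl
  ... | inj₁ refl | inj₂ refl | inj₂ refl = yz refl
  ... | inj₂ refl | inj₁ refl | inj₁ refl = yz refl
  ... | inj₂ refl | inj₁ refl | inj₂ refl = xz refl
  ... | inj₂ refl | inj₂ refl | _ = xy refl

  unique₂ : ∀ {p q r κ κ′} (b : Block₂ κ) (b′ : Block₂ κ′) → Distinct p q r →
            Through p q r (pts₂ b) → Through p q r (pts₂ b′) →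
            _≡_ {A = Σ Kind Block₂} (κ , b) (κ′ , b′)
  unique₂ (pair i j i<j) (pair i′ j′ i′<j′) d th th′
    with firstIs⇒∈ th′ (proj₁ (both d th)) | firstIs⇒∈ th′ (proj₂ (both d th))
  ... | inj₁ refl | inj₂ refl = refl
  ... | inj₁ refl | inj₁ refl = contradiction refl (<⇒≢ i<j)
  ... | inj₂ refl | inj₂ refl = contradiction refl (<⇒≢ i<j)
  ... | inj₂ refl | inj₁ refl = ⊥-elim-irr (Fin.<-asym i<j i′<j′)
  unique₂ (pair i j _) (lift b w) d th th′ =
    contradiction (liftOf-transversal D b w d th′) (side-¬transversal th)
  unique₂ (lift b w) (pair i j _) d th th′ =
    contradiction (liftOf-transversal D b w d th) (side-¬transversal th′)
  unique₂ (lift b w) (lift b′ w′) d th th′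
    with refl ← liftOf-unique D b w b′ w′ (liftOf-transversal D b w d th) th th′ = refl

  double : Design (Fin u × Bool) Distinct
  double = record { Block = Block₂ ; pts = pts₂ ; pts-inj = pts₂-inj ; cover = cover₂ ; unique = unique₂ }

-- Delete ∞ and double every other point. A block avoiding ∞ is inflated, and a block through
-- ∞ is replaced by a full design (on 6 or 10 points) on the fibres over its other points; the
-- latter also cover the triples with two points in one fibre. The order becomes 2u − 2.
module Puncture {X : Set} (_≟_ : DecidableEquality X) (D : Design X Distinct) (∞ : X) where
  open Design D

  Rest : Set
  Rest = ∃ λ x → x ≢ ∞

  -- Refutations are definitionally equal, the empty type being proof-irrelevant.
  rest-≡ : {p q : Rest} → proj₁ p ≡ proj₁ q → p ≡ q
  rest-≡ refl = refl

  rest² : {p q : Rest × Bool} → map₁ proj₁ p ≡ map₁ proj₁ q → p ≡ q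
  rest² refl = refl

  avoid : ∀ {κ} (b : Block κ) → (∀ c → pts b c ≢ ∞) → Fin (size κ) → Rest
  avoid b n c = pts b c , n c

  avoid-inj : ∀ {κ} (b : Block κ) n → Injection (avoid b n)
  avoid-inj b n = pts-inj b ∘ cong proj₁

  derived : ∀ {κ} (b : Block κ) c → .(pts b c ≡ ∞) → Fin (derivedSize κ) → Rest
  derived b c e c′ = pts b (punchIn c c′) , λ e′ →
    ⊥-elim-irr (Fin.punchInᵢ≢i c c′ (pts-inj b (trans e′ (sym e))))

  derived-inj : ∀ {κ} (b : Block κ) c .e → Injection (derived b c e)
  derived-inj b c e = Fin.punchIn-injective c _ _ ∘ pts-inj b ∘ cong proj₁

  data Blockₚ : Kind → Set where
    lift : ∀ {κ κ′} (b : Block κ) → (∀ c → pts b c ≢ ∞) → LiftBlock κ κ′ → Blockₚ κ′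
    fill : ∀ {κ κ′} (b : Block κ) (c : Fin (size κ)) → .(pts b c ≡ ∞) → FillBlock κ κ′ → Blockₚ κ′

  ptsₚ : ∀ {κ} → Blockₚ κ → Fin (size κ) → Rest × Bool
  ptsₚ (lift {κ} b n w)   = Inflate.inflate (Lift κ) (avoid b n) (avoid-inj b n) w
  ptsₚ (fill {κ} b c e w) = Inflate.inflate (Fill κ) (derived b c e) (derived-inj b c e) w

  ptsₚ-inj : ∀ {κ} (b : Blockₚ κ) → Injection (ptsₚ b)
  ptsₚ-inj (lift {κ} b n w)   = Inflate.inflate-inj (Lift κ) (avoid b n) (avoid-inj b n) w
  ptsₚ-inj (fill {κ} b c e w) = Inflate.inflate-inj (Fill κ) (derived b c e) (derived-inj b c e) w

  derived⁺ : ∀ {κ} {b : Block κ} {c} .{e : pts b c ≡ ∞} {x : Rest} → proj₁ x ∈ᶠ pts b → x ∈ᶠ derived b c e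
  derived⁺ {b = b} {c} {e} {x , x≢∞} (i , refl) = Fin.punchOut c≢i , rest-≡ (cong (pts b) (Fin.punchIn-punchOut c≢i))
    where
    c≢i : c ≢ i
    c≢i refl = ⊥-elim-irr (x≢∞ e)

  fill-cover : ∀ {κ} (b : Block κ) c → pts b c ≡ ∞ → ∀ {p q r : Rest × Bool} → Distinct p q r →
    Through (proj₁ (proj₁ p)) (proj₁ (proj₁ q)) (proj₁ (proj₁ r)) (pts b) →
    ∃₂ λ κ (b : Blockₚ κ) → Through p q r (ptsₚ b)
  fill-cover {κ} b c e {x , _} {y , _} {z , _} (pq , pr , qr) (x∈ , y∈ , z∈)
    with derived⁺ {e = e} {x} x∈ | derived⁺ {e = e} {y} y∈ | derived⁺ {e = e} {z} z∈
  ... | i , refl | j , refl | l , refl =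
    let κ′ , w , th = Inflate.inflate-cover (Fill κ) (derived b c e) (derived-inj b c e)
                        ( pq ∘ cong (map₁ (derived b c e)) , pr ∘ cong (map₁ (derived b c e))
                        , qr ∘ cong (map₁ (derived b c e)))
    in κ′ , fill b c e w , th

  coverₚ : ∀ {p q r} → Distinct p q r → ∃₂ λ κ (b : Blockₚ κ) → Through p q r (ptsₚ b)
  coverₚ {(x , x≢∞) , α} {(y , y≢∞) , β} {(z , z≢∞) , γ} d@(pq , pr , qr) with x ≟ y | x ≟ z | y ≟ z
  ... | yes refl | yes refl | _ = contradiction refl (third≢ pq pr qr)
  ... | yes refl | no xz | _ =
        let κ , b , (c , e) , x∈ , z∈ = cover (x≢∞ ∘ sym , z≢∞ ∘ sym , xz) in fill-cover b c e d (x∈ , x∈ , z∈)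
  ... | no xy | yes refl | _ =
        let κ , b , (c , e) , x∈ , y∈ = cover (x≢∞ ∘ sym , y≢∞ ∘ sym , xy) in fill-cover b c e d (x∈ , y∈ , x∈)
  ... | no xy | no _ | yes refl =
        let κ , b , (c , e) , x∈ , y∈ = cover (x≢∞ ∘ sym , y≢∞ ∘ sym , xy) in fill-cover b c e d (x∈ , y∈ , y∈)
  ... | no xy | no xz | no yz with cover (xy , xz , yz)
  ... | κ , b , th@((i , refl) , (j , refl) , (l , refl)) with Fin.any? (λ c → pts b c ≟ ∞)
  ... | yes (c , e) = fill-cover b c e d th
  ... | no ∄c =
        let n = λ c e → ∄c (c , e)
            κ′ , w , th′ = Inflate.inflate-cover (Lift κ) (avoid b n) (avoid-inj b n) {i} {j} {l} {α} {β} {γ}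
                             (xy ∘ cong (pts b) , xz ∘ cong (pts b) , yz ∘ cong (pts b))
        in κ′ , lift b n w , th′

  fill-base : ∀ {κ κ′} (b : Block κ) c .(e : pts b c ≡ ∞) (w : FillBlock κ κ′) {p} → p ∈ᶠ ptsₚ (fill b c e w) →
    proj₁ (proj₁ p) ∈ᶠ pts b
  fill-base {κ} b c e w (l , refl) = punchIn c (proj₁ (fillPts κ w l)) , refl

  lift-base : ∀ {κ κ′} (b : Block κ) n (w : LiftBlock κ κ′) {p} → p ∈ᶠ ptsₚ (lift b n w) →
    (proj₁ (proj₁ p) , proj₂ p) ∈ᶠ liftOf D b w
  lift-base b n w (l , refl) = l , refl

  lift-through : ∀ {κ κ′} (b : Block κ) n (w : LiftBlock κ κ′) {p q r} → Through p q r (ptsₚ (lift b n w)) →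
    Through (map₁ proj₁ p) (map₁ proj₁ q) (map₁ proj₁ r) (liftOf D b w)
  lift-through b n w (x∈ , y∈ , z∈) = lift-base b n w x∈ , lift-base b n w y∈ , lift-base b n w z∈

  -- A common triple would be transversal, so its projections would force the two old blocks to
  -- coincide; but one avoids `∞` and the other contains it.
  lift≢fill : ∀ {p q r κ κ′ ι ι′} (b : Block κ) n (w : LiftBlock κ ι) (b′ : Block κ′) c .(e : pts b′ c ≡ ∞)
    (w′ : FillBlock κ′ ι′) → Distinct p q r →
    Through p q r (ptsₚ (lift b n w)) → ¬ Through p q r (ptsₚ (fill b′ c e w′))
  lift≢fill {p} {q} {r} {κ} b n w b′ c e w′ (pq , pr , qr) th (x∈ , y∈ , z∈)
    with refl ← unique b b′ (liftOf-transversal D b w (pq ∘ rest² , pr ∘ rest² , qr ∘ rest²) (lift-through b n w th))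
           (through-base {I = Lift κ} {w = w} (lift-through b n w th))
           (fill-base b′ c e w′ x∈ , fill-base b′ c e w′ y∈ , fill-base b′ c e w′ z∈)
    = ⊥-elim-irr (n c e)

  same-position : ∀ {κ} (b : Block κ) c c′ → .(pts b c ≡ ∞) → .(pts b c′ ≡ ∞) → c ≡ c′
  same-position b c c′ e e′ with c Fin.≟ c′
  ... | yes c≡c′ = c≡c′
  ... | no  c≢c′ = ⊥-elim-irr (c≢c′ (pts-inj b (trans e (sym e′))))

  -- An irrelevant equation is no witness by itself; deciding the equality recovers one.
  ∞∈ : ∀ {κ} (b : Block κ) c → .(pts b c ≡ ∞) → ∞ ∈ᶠ pts b
  ∞∈ b c e with pts b c ≟ ∞
  ... | yes c≡∞ = c , c≡∞
  ... | no  c≢∞ = ⊥-elim-irr (c≢∞ e)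

  -- The projections of the triple need not be distinct, but at least two are. Together with `∞`,
  -- which lies on both old blocks, they form the triple to which `unique` applies.
  same-base : ∀ {p q r κ κ′ ι ι′} (b : Block κ) c .(e : pts b c ≡ ∞) (w : FillBlock κ ι)
    (b′ : Block κ′) c′ .(e′ : pts b′ c′ ≡ ∞) (w′ : FillBlock κ′ ι′) → Distinct p q r →
    Through p q r (ptsₚ (fill b c e w)) → Through p q r (ptsₚ (fill b′ c′ e′ w′)) →
    _≡_ {A = Σ Kind Block} (κ , b) (κ′ , b′)
  same-base {(x , x≢∞) , _} {(y , y≢∞) , _} {(z , z≢∞) , _} b c e w b′ c′ e′ w′
    (pq , pr , qr) (x∈ , y∈ , z∈) (x∈′ , y∈′ , z∈′)
    with x ≟ y
  ... | no x≢y = unique b b′ (x≢∞ ∘ sym , y≢∞ ∘ sym , x≢y)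
    (∞∈ b c e , fill-base b c e w x∈ , fill-base b c e w y∈)
    (∞∈ b′ c′ e′ , fill-base b′ c′ e′ w′ x∈′ , fill-base b′ c′ e′ w′ y∈′)
  ... | yes refl = unique b b′ (x≢∞ ∘ sym , z≢∞ ∘ sym , third≢ pq pr qr ∘ rest-≡)
    (∞∈ b c e , fill-base b c e w x∈ , fill-base b c e w z∈)
    (∞∈ b′ c′ e′ , fill-base b′ c′ e′ w′ x∈′ , fill-base b′ c′ e′ w′ z∈′)

  uniqueₚ : ∀ {p q r κ κ′} (b : Blockₚ κ) (b′ : Blockₚ κ′) → Distinct p q r →
            Through p q r (ptsₚ b) → Through p q r (ptsₚ b′) →
            _≡_ {A = Σ Kind Blockₚ} (κ , b) (κ′ , b′)
  uniqueₚ (lift b n w) (lift b′ n′ w′) (pq , pr , qr) th th′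
    with refl ← liftOf-unique D b w b′ w′
           (liftOf-transversal D b w (pq ∘ rest² , pr ∘ rest² , qr ∘ rest²) (lift-through b n w th))
           (lift-through b n w th) (lift-through b′ n′ w′ th′) = refl
  uniqueₚ (lift b n w) (fill b′ c e w′) d th th′ = contradiction th′ (lift≢fill b n w b′ c e w′ d th)
  uniqueₚ (fill b c e w) (lift b′ n w′) d th th′ = contradiction th (lift≢fill b′ n w′ b c e w d th′)
  uniqueₚ {p} {q} {r} (fill {κ} b c e w) (fill b′ c′ e′ w′) d th th′
    with refl ← same-base b c e w b′ c′ e′ w′ d th th′
    with refl ← same-position b c c′ e e′
    with refl ← Inflate.inflate-unique (Fill κ) (derived b c e) (derived-inj b c e) w w′
                  (λ { refl refl refl → let (pq , pr , qr) = d in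
                       pq ∘ cong (map₁ (derived b c e)) , pr ∘ cong (map₁ (derived b c e)) ,
                       qr ∘ cong (map₁ (derived b c e)) })
                  th th′ = refl

  puncture : Design (Rest × Bool) Distinct
  puncture = record { Block = Blockₚ ; pts = ptsₚ ; pts-inj = ptsₚ-inj ; cover = coverₚ ; unique = uniqueₚ }

-- Designs containing a large boolean transversal design

infixl 6 _⊕_
_⊕_ : ∀ {K} → Vec Bool K → Vec Bool K → Vec Bool K
_⊕_ = zipWith _xor_

quad : {A : Set} → (A → A → A → A) → A → A → A → Fin 4 → A
quad L x y z 0F = x
quad L x y z 1F = y
quad L x y z 2F = z
quad L x y z 3F = L x y z

sum₃ : ∀ {K} → Vec Bool K → Vec Bool K → Vec Bool K → Vec Bool K
sum₃ x y z = x ⊕ (y ⊕ z)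

-- The two spare points keep the subsystem intact when one of them is deleted.
record Boolean (X : Set) (K : ℕ) : Set₁ where
  field
    design : Design X Distinct
  open Design design public
  field
    point     : Fin 4 → Vec Bool K → X
    point-inj : ∀ {i j x y} → point i x ≡ point j y → (i , x) ≡ (j , y)
    tblock    : (x y z : Vec Bool K) → Block four
    tblock-pts : ∀ x y z i → pts (tblock x y z) i ≡ point i (quad sum₃ x y z i)
    spare spare′ : X
    spare≢   : spare ≢ spare′
    spare-free  : ∀ i x → point i x ≢ spare
    spare-free′ : ∀ i x → point i x ≢ spare′

module _ {X Y : Set} (f : X → Y) (f-inj : Injection f) (f-surj : ∀ y → ∃ λ x → f x ≡ y) where

  through⁺ : ∀ {n x y z} {g : Fin n → X} → Through x y z g → Through (f x) (f y) (f z) (f ∘ g)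
  through⁺ ((i , refl) , (j , refl) , (l , refl)) = (i , refl) , (j , refl) , (l , refl)

  through⁻ : ∀ {n x y z} {g : Fin n → X} → Through (f x) (f y) (f z) (f ∘ g) → Through x y z g
  through⁻ ((i , e) , (j , e′) , (l , e″)) = (i , f-inj e) , (j , f-inj e′) , (l , f-inj e″)

  transport : Design X Distinct → Design Y Distinct
  transport D = record
    { Block = Block
    ; pts = λ b → f ∘ pts b
    ; pts-inj = λ b → pts-inj b ∘ f-inj
    ; cover = cover′
    ; unique = unique′
    }
    where
    open Design D
    cover′ : ∀ {x y z} → Distinct x y z → ∃₂ λ κ (b : Block κ) → Through x y z (f ∘ pts b)
    cover′ {x} {y} {z} (xy , xz , yz) with f-surj x | f-surj y | f-surj z
    ... | x , refl | y , refl | z , refl =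
      let κ , b , th = cover (xy ∘ cong f , xz ∘ cong f , yz ∘ cong f) in κ , b , through⁺ th
    unique′ : ∀ {x y z κ κ′} (b : Block κ) (b′ : Block κ′) → Distinct x y z →
              Through x y z (f ∘ pts b) → Through x y z (f ∘ pts b′) →
              _≡_ {A = Σ Kind Block} (κ , b) (κ′ , b′)
    unique′ {x} {y} {z} b b′ (xy , xz , yz) th th′ with f-surj x | f-surj y | f-surj z
    ... | x , refl | y , refl | z , refl =
      unique b b′ (xy ∘ cong f , xz ∘ cong f , yz ∘ cong f) (through⁻ th) (through⁻ th′)

  transportBoolean : ∀ {K} → Boolean X K → Boolean Y K
  transportBoolean R = record
    { design      = transport design
    ; point       = λ i x → f (point i x)
    ; point-inj   = point-inj ∘ f-inj
    ; tblock      = tblock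
    ; tblock-pts  = λ x y z i → cong f (tblock-pts x y z i)
    ; spare       = f spare
    ; spare′      = f spare′
    ; spare≢      = spare≢ ∘ f-inj
    ; spare-free  = λ i x → spare-free i x ∘ f-inj
    ; spare-free′ = λ i x → spare-free′ i x ∘ f-inj
    }
    where open Boolean R

doublePoint-inj : ∀ {X : Set} {K} (point : Fin 4 → Vec Bool K → X) →
  (∀ {i j x y} → point i x ≡ point j y → (i , x) ≡ (j , y)) →
  ∀ {i j ε δ x y} → (point i x , ε) ≡ (point j y , δ) → _≡_ {A = Fin 4 × Vec Bool (suc K)} (i , ε ∷ x) (j , δ ∷ y)
doublePoint-inj point inj e with refl ← inj (cong proj₁ e) | refl ← cong proj₂ e = refl

doubleBoolean : ∀ {u K} → Boolean (Fin u) K → Boolean (Fin u × Bool) (suc K)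
doubleBoolean {u} {K} R = record
  { design      = double
  ; point       = point₂
  ; point-inj   = λ { {x = ε ∷ x} {δ ∷ y} → doublePoint-inj point point-inj }
  ; tblock      = tblock₂
  ; tblock-pts  = tblock₂-pts
  ; spare       = spare , false
  ; spare′      = spare′ , false
  ; spare≢      = spare≢ ∘ cong proj₁
  ; spare-free  = λ { i (_ ∷ x) → spare-free i x ∘ cong proj₁ }
  ; spare-free′ = λ { i (_ ∷ x) → spare-free′ i x ∘ cong proj₁ }
  }
  where
  open Boolean R
  open Double design
  point₂ : Fin 4 → Vec Bool (suc K) → Fin u × Bool
  point₂ i (ε ∷ x) = point i x , ε
  tblock₂ : (x y z : Vec Bool (suc K)) → Block₂ four
  tblock₂ (a ∷ x) (b ∷ y) (c ∷ z) = lift (tblock x y z) (a , b , c)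
  tblock₂-pts : ∀ x y z i → pts₂ (tblock₂ x y z) i ≡ point₂ i (quad sum₃ x y z i)
  tblock₂-pts (a ∷ x) (b ∷ y) (c ∷ z) 0F = cong (_, a) (tblock-pts x y z 0F)
  tblock₂-pts (a ∷ x) (b ∷ y) (c ∷ z) 1F = cong (_, b) (tblock-pts x y z 1F)
  tblock₂-pts (a ∷ x) (b ∷ y) (c ∷ z) 2F = cong (_, c) (tblock-pts x y z 2F)
  tblock₂-pts (a ∷ x) (b ∷ y) (c ∷ z) 3F = cong (_, a xor (b xor c)) (tblock-pts x y z 3F)

punctureBoolean : ∀ {X K} (_≟_ : DecidableEquality X) (R : Boolean X K) →
  Boolean ((∃ λ x → x ≢ Boolean.spare R) × Bool) (suc K)
punctureBoolean {X} {K} _≟_ R = record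
  { design      = puncture
  ; point       = pointₚ
  ; point-inj   = λ { {x = ε ∷ x} {δ ∷ y} e → doublePoint-inj point point-inj (cong (map₁ proj₁) e) }
  ; tblock      = tblockₚ
  ; tblock-pts  = tblockₚ-pts
  -- One spare point is deleted; the two points over the other one are the new spares.
  ; spare       = (spare′ , spare≢ ∘ sym) , false
  ; spare′      = (spare′ , spare≢ ∘ sym) , true
  ; spare≢      = λ ()
  ; spare-free  = λ { i (_ ∷ x) → spare-free′ i x ∘ cong (proj₁ ∘ proj₁) }
  ; spare-free′ = λ { i (_ ∷ x) → spare-free′ i x ∘ cong (proj₁ ∘ proj₁) }
  }
  where
  open Boolean R
  open Puncture _≟_ design spare
  pointₚ : Fin 4 → Vec Bool (suc K) → Rest × Bool
  pointₚ i (ε ∷ x) = (point i x , spare-free i x) , ε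
  tblockₚ : (x y z : Vec Bool (suc K)) → Blockₚ four
  tblockₚ (a ∷ x) (b ∷ y) (c ∷ z) =
    lift (tblock x y z) (λ i e → spare-free i _ (trans (sym (tblock-pts x y z i)) e)) (a , b , c)
  tblockₚ-pts : ∀ x y z i → ptsₚ (tblockₚ x y z) i ≡ pointₚ i (quad sum₃ x y z i)
  tblockₚ-pts (a ∷ x) (b ∷ y) (c ∷ z) 0F = cong (_, a) (rest-≡ (tblock-pts x y z 0F))
  tblockₚ-pts (a ∷ x) (b ∷ y) (c ∷ z) 1F = cong (_, b) (rest-≡ (tblock-pts x y z 1F))
  tblockₚ-pts (a ∷ x) (b ∷ y) (c ∷ z) 2F = cong (_, c) (rest-≡ (tblock-pts x y z 2F))
  tblockₚ-pts (a ∷ x) (b ∷ y) (c ∷ z) 3F = cong (_, a xor (b xor c)) (rest-≡ (tblock-pts x y z 3F))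

-- Initial designs and recursion on the order

trivial : ∀ κ → Design (Fin (size κ)) Distinct
trivial κ = record
  { Block   = κ ≡_
  ; pts     = λ { refl → id }
  ; pts-inj = λ { refl → id }
  ; cover   = λ _ → κ , refl , (_ , refl) , (_ , refl) , (_ , refl)
  ; unique  = λ { refl refl _ _ _ → refl }
  }

avoids? : ∀ {m} (g : Fin 4 → Fin m × Bool) p → Dec (∀ i → g i ≢ p)
avoids? g p = Fin.all? λ i → ¬? (Product.≡-dec Fin._≟_ Bool._≟_ (g i) p)

-- For K = 0 each group is a single point, so any 4-block is a transversal design; it only remains
-- to name two points off it.
singleBlock : ∀ {m} (D : Design (Fin m × Bool) Distinct) (b : Design.Block D four) (p q : Fin m × Bool) → p ≢ q →
  {True (avoids? (Design.pts D b) p)} → {True (avoids? (Design.pts D b) q)} → Boolean (Fin m × Bool) 0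
singleBlock D b p q p≢q {p∉} {q∉} = record
  { design      = D
  ; point       = λ i _ → Design.pts D b i
  ; point-inj   = λ { {x = []} {[]} e → cong (_, []) (Design.pts-inj D b e) }
  ; tblock      = λ _ _ _ → b
  ; tblock-pts  = λ { x y z 0F → refl ; x y z 1F → refl ; x y z 2F → refl ; x y z 3F → refl }
  ; spare       = p
  ; spare′      = q
  ; spare≢      = p≢q
  ; spare-free  = λ i _ → toWitness p∉ i
  ; spare-free′ = λ i _ → toWitness q∉ i
  }

boolean₈ : Boolean (Fin 4 × Bool) 0
boolean₈ = singleBlock (Double.double (trivial four)) (Double.lift refl (false , false , false))
  (0F , true) (1F , true) (λ ())

boolean₁₀ : Boolean (Fin 5 × Bool) 0
-- The spares are the elements 5 and 6 of ℤ₁₀, which are off the base block {0, 1, 3, 4}.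
boolean₁₀ = singleBlock (Fill six) (0F , 0F) (fillPts six (5F , 0F) 0F) (fillPts six (6F , 0F) 0F) (λ ())

boolean₁₂ : Boolean (Fin 6 × Bool) 0
boolean₁₂ = singleBlock (Double.double (trivial six)) (Double.pair 0F 1F (s≤s z≤n))
  (2F , false) (3F , false) (λ ())

label : ∀ {u} → Fin u × Bool → Fin (u * 2)
label (x , false) = Fin.combine {_} {2} x 0F
label (x , true)  = Fin.combine {_} {2} x 1F

label-inj : ∀ {u} → Injection (label {u})
label-inj {x = x , false} {y , false} e = cong (_, false) (Fin.combine-injectiveˡ x 0F y 0F e)
label-inj {x = x , false} {y , true}  e with () ← Fin.combine-injectiveʳ x 0F y 1F e
label-inj {x = x , true}  {y , false} e with () ← Fin.combine-injectiveʳ x 1F y 0F e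
label-inj {x = x , true}  {y , true}  e = cong (_, true) (Fin.combine-injectiveˡ x 1F y 1F e)

label-surj : ∀ {u} (y : Fin (u * 2)) → ∃ λ x → label x ≡ y
label-surj {u} y with Fin.combine-surjective {u} {2} y
... | x , 0F , e = (x , false) , e
... | x , 1F , e = (x , true) , e

labelRest : ∀ {u} (∞ : Fin (suc u)) → (∃ λ x → x ≢ ∞) × Bool → Fin u × Bool
labelRest ∞ ((x , x≢∞) , ε) = punchOut (x≢∞ ∘ sym) , ε

labelRest-inj : ∀ {u} (∞ : Fin (suc u)) → Injection (labelRest ∞)
labelRest-inj ∞ {(x , x≢∞) , ε} {(y , y≢∞) , δ} e
  with refl ← Fin.punchOut-injective (x≢∞ ∘ sym) (y≢∞ ∘ sym) (cong proj₁ e) | refl ← cong proj₂ e = refl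

labelRest-surj : ∀ {u} (∞ : Fin (suc u)) y → ∃ λ x → labelRest ∞ x ≡ y
labelRest-surj ∞ (y , ε) = ((punchIn ∞ y , Fin.punchInᵢ≢i ∞ y) , ε) , cong (_, ε) (Fin.punchOut-punchIn ∞)

BooleanOrder : ℕ → Set₁
BooleanOrder n = Σ ℕ λ K → n ≤ 6 * 2 ^ K × Boolean (Fin (n * 2)) K

twice-bound : ∀ {m} K → m ≤ 6 * 2 ^ K → m * 2 ≤ 6 * 2 ^ suc K
twice-bound {m} K m≤ = begin
  m * 2           ≤⟨ ℕ.*-monoˡ-≤ 2 m≤ ⟩
  6 * 2 ^ K * 2   ≡⟨ ℕ.*-assoc 6 (2 ^ K) 2 ⟩
  6 * (2 ^ K * 2) ≡⟨ cong (6 *_) (ℕ.*-comm (2 ^ K) 2) ⟩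
  6 * 2 ^ suc K   ∎
  where open ℕ.≤-Reasoning

boolean-double : ∀ {m} → BooleanOrder m → BooleanOrder (m * 2)
boolean-double (K , m≤ , R) = suc K , twice-bound K m≤ ,
  transportBoolean label label-inj label-surj (doubleBoolean R)

boolean-puncture : ∀ {m} → BooleanOrder (suc m) → BooleanOrder (suc (m * 2))
boolean-puncture (K , m≤ , R) = suc K , ℕ.≤-trans (ℕ.n≤1+n _) (twice-bound K m≤) ,
  transportBoolean label label-inj label-surj
    (transportBoolean (labelRest spare) (labelRest-inj spare) (labelRest-surj spare) (punctureBoolean Fin._≟_ R))
  where open Boolean R using (spare)

parity : ∀ n → ∃ λ m → n ≡ m * 2 ⊎ n ≡ suc (m * 2)
parity zero    = 0 , inj₁ refl
parity (suc n) with parity n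
... | m , inj₁ refl = m , inj₂ refl
... | m , inj₂ refl = suc m , inj₁ refl

-- An even n comes from n/2 by doubling, an odd n from (n + 1)/2 by puncturing. From n = 7 on both
-- are at least 4, which leaves 4, 5 and 6 as initial cases.
booleanOrder : ∀ n → 4 ≤ n → BooleanOrder n
booleanOrder = <-rec _ step
  where
  step : ∀ n → (∀ {m} → m < n → 4 ≤ m → BooleanOrder m) → 4 ≤ n → BooleanOrder n
  step 1 _ (s≤s ())
  step 2 _ (s≤s (s≤s ()))
  step 3 _ (s≤s (s≤s (s≤s ())))
  step 4 _ _ = 0 , from-yes (4 ℕ.≤? 6) , transportBoolean label label-inj label-surj boolean₈
  step 5 _ _ = 0 , from-yes (5 ℕ.≤? 6) , transportBoolean label label-inj label-surj boolean₁₀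
  step 6 _ _ = 0 , from-yes (6 ℕ.≤? 6) , transportBoolean label label-inj label-surj boolean₁₂
  step n@(suc (suc (suc (suc (suc (suc (suc _))))))) rec _ with parity n
  ... | suc (suc (suc (suc m))) , inj₁ refl =
    boolean-double (rec (s≤s (s≤s (s≤s (s≤s (s≤s (ℕ.m≤n⇒m≤o+n 3 (ℕ.m≤m*n m 2))))))) (s≤s (s≤s (s≤s (s≤s z≤n)))))
  ... | suc (suc (suc m)) , inj₂ refl =
    boolean-puncture (rec (s≤s (s≤s (s≤s (s≤s (s≤s (ℕ.m≤n⇒m≤o+n 2 (ℕ.m≤m*n m 2))))))) (s≤s (s≤s (s≤s (s≤s z≤n)))))

-- Arithmetic in ℤ₂ᴷ

⊕-assoc : ∀ {K} (x y z : Vec Bool K) → (x ⊕ y) ⊕ z ≡ x ⊕ (y ⊕ z)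
⊕-assoc = Vec.zipWith-assoc Bool.xor-assoc

⊕-comm : ∀ {K} (x y : Vec Bool K) → x ⊕ y ≡ y ⊕ x
⊕-comm = Vec.zipWith-comm Bool.xor-comm

zeros : ∀ {K} → Vec Bool K
zeros = replicate _ false

⊕-zeros : ∀ {K} (x : Vec Bool K) → x ⊕ zeros ≡ x
⊕-zeros = Vec.zipWith-identityʳ Bool.xor-identityʳ

⊕-cancel : ∀ {K} (x y : Vec Bool K) → (x ⊕ y) ⊕ y ≡ x
⊕-cancel [] [] = refl
⊕-cancel (a ∷ x) (b ∷ y) = cong₂ _∷_
  (trans (Bool.xor-assoc a b b) (trans (cong (a xor_) (Bool.xor-same b)) (Bool.xor-identityʳ a))) (⊕-cancel x y)

⊕-swap : ∀ {K} (x y z : Vec Bool K) → (x ⊕ y) ⊕ z ≡ (x ⊕ z) ⊕ y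
⊕-swap x y z = trans (⊕-assoc x y z) (trans (cong (x ⊕_) (⊕-comm y z)) (sym (⊕-assoc x z y)))

-- Latin cubes obtained by flipping disjoint subcubes

-- The invariances make x + y + z + Δ x y z a Latin cube again.
record Flip (K : ℕ) : Set where
  field
    Δ : Vec Bool K → Vec Bool K → Vec Bool K → Vec Bool K
    Δ-x : ∀ x y z → Δ (x ⊕ Δ x y z) y z ≡ Δ x y z
    Δ-y : ∀ x y z → Δ x (y ⊕ Δ x y z) z ≡ Δ x y z
    Δ-z : ∀ x y z → Δ x y (z ⊕ Δ x y z) ≡ Δ x y z

-- On a line of the cube the symbol is x + c + δ x. By `δ-inv` the map x ↦ x + δ x is an involution,
-- so the inverse is explicit.
module Shear {K : ℕ} (δ : Vec Bool K → Vec Bool K) (δ-inv : ∀ x → δ (x ⊕ δ x) ≡ δ x) (c : Vec Bool K) where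

  preimage : Vec Bool K → Vec Bool K
  preimage w = (w ⊕ c) ⊕ δ (w ⊕ c)

  preimage-correct : ∀ w → (preimage w ⊕ c) ⊕ δ (preimage w) ≡ w
  preimage-correct w = begin
    (preimage w ⊕ c) ⊕ δ (preimage w)            ≡⟨ cong ((preimage w ⊕ c) ⊕_) (δ-inv (w ⊕ c)) ⟩
    (((w ⊕ c) ⊕ δ (w ⊕ c)) ⊕ c) ⊕ δ (w ⊕ c)      ≡⟨ ⊕-swap _ c _ ⟩
    (((w ⊕ c) ⊕ δ (w ⊕ c)) ⊕ δ (w ⊕ c)) ⊕ c      ≡⟨ cong (_⊕ c) (⊕-cancel (w ⊕ c) _) ⟩
    (w ⊕ c) ⊕ c                                  ≡⟨ ⊕-cancel w c ⟩
    w                                            ∎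
    where open ≡-Reasoning

  preimage-unique : ∀ x {w} → (x ⊕ c) ⊕ δ x ≡ w → x ≡ preimage w
  preimage-unique x refl = sym (begin
    preimage ((x ⊕ c) ⊕ δ x)       ≡⟨ cong (λ u → u ⊕ δ u) e ⟩
    (x ⊕ δ x) ⊕ δ (x ⊕ δ x)        ≡⟨ cong ((x ⊕ δ x) ⊕_) (δ-inv x) ⟩
    (x ⊕ δ x) ⊕ δ x                ≡⟨ ⊕-cancel x (δ x) ⟩
    x                              ∎)
    where
    open ≡-Reasoning
    e : ((x ⊕ c) ⊕ δ x) ⊕ c ≡ x ⊕ δ x
    e = trans (⊕-swap (x ⊕ c) (δ x) c) (cong (_⊕ δ x) (⊕-cancel x c))

  injective : ∀ x x′ → (x ⊕ c) ⊕ δ x ≡ (x′ ⊕ c) ⊕ δ x′ → x ≡ x′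
  injective x x′ e = trans (preimage-unique x e) (sym (preimage-unique x′ refl))

module Latin {K : ℕ} (F : Flip K) where
  open Flip F

  V : Set
  V = Vec Bool K

  L : V → V → V → V
  L x y z = sum₃ x y z ⊕ Δ x y z

  entry : V × V × V → Fin 4 → V
  entry (x , y , z) = quad L x y z

  L-y : ∀ x y z → L x y z ≡ (y ⊕ (x ⊕ z)) ⊕ Δ x y z
  L-y x y z = cong (_⊕ Δ x y z) (trans (sym (⊕-assoc x y z)) (trans (cong (_⊕ z) (⊕-comm x y)) (⊕-assoc y x z)))

  L-z : ∀ x y z → L x y z ≡ (z ⊕ (x ⊕ y)) ⊕ Δ x y z
  L-z x y z = cong (_⊕ Δ x y z) (trans (sym (⊕-assoc x y z)) (⊕-comm (x ⊕ y) z))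

  module X (y z : V) = Shear (λ x → Δ x y z) (λ x → Δ-x x y z) (y ⊕ z)
  module Y (x z : V) = Shear (λ y → Δ x y z) (λ y → Δ-y x y z) (x ⊕ z)
  module Z (x y : V) = Shear (λ z → Δ x y z) (λ z → Δ-z x y z) (x ⊕ y)

  -- The symbol counts as a fourth coordinate. If it is the missing one, the cube is evaluated;
  -- otherwise the shear in the missing direction is inverted.
  complete : ∀ m (t : Fin 4 → V) → ∃ λ s → ∀ i → i ≢ m → entry s i ≡ t i
  complete 0F t = (X.preimage (t 1F) (t 2F) (t 3F) , t 1F , t 2F) , λ where
    0F ≢ → contradiction refl ≢
    1F _ → refl
    2F _ → refl
    3F _ → X.preimage-correct (t 1F) (t 2F) (t 3F)
  complete 1F t = (t 0F , Y.preimage (t 0F) (t 2F) (t 3F) , t 2F) , λ where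
    0F _ → refl
    1F ≢ → contradiction refl ≢
    2F _ → refl
    3F _ → trans (L-y (t 0F) _ (t 2F)) (Y.preimage-correct (t 0F) (t 2F) (t 3F))
  complete 2F t = (t 0F , t 1F , Z.preimage (t 0F) (t 1F) (t 3F)) , λ where
    0F _ → refl
    1F _ → refl
    2F ≢ → contradiction refl ≢
    3F _ → trans (L-z (t 0F) (t 1F) _) (Z.preimage-correct (t 0F) (t 1F) (t 3F))
  complete 3F t = (t 0F , t 1F , t 2F) , λ where
    0F _ → refl
    1F _ → refl
    2F _ → refl
    3F ≢ → contradiction refl ≢

  determined : ∀ m s s′ → (∀ i → i ≢ m → entry s i ≡ entry s′ i) → s ≡ s′
  determined 0F (x , y , z) (x′ , y′ , z′) e with refl ← e 1F (λ ()) | refl ← e 2F (λ ()) =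
    cong (λ x → x , y , z) (X.injective y z x x′ (e 3F (λ ())))
  determined 1F (x , y , z) (x′ , y′ , z′) e with refl ← e 0F (λ ()) | refl ← e 2F (λ ()) =
    cong (λ y → x , y , z) (Y.injective x z y y′ (trans (sym (L-y x y z)) (trans (e 3F (λ ())) (L-y x y′ z))))
  determined 2F (x , y , z) (x′ , y′ , z′) e with refl ← e 0F (λ ()) | refl ← e 1F (λ ()) =
    cong (λ z → x , y , z) (Z.injective x y z z′ (trans (sym (L-z x y z)) (trans (e 3F (λ ())) (L-z x y z′))))
  determined 3F (x , y , z) (x′ , y′ , z′) e with refl ← e 0F (λ ()) | refl ← e 1F (λ ()) | refl ← e 2F (λ ()) = refl

noFlip : ∀ {K} → Flip K
noFlip = record { Δ = λ _ _ _ → zeros ; Δ-x = λ _ _ _ → refl ; Δ-y = λ _ _ _ → refl ; Δ-z = λ _ _ _ → refl }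

-- Counting

module _ {A : Set} where

  remove : {x : A} {ys : List A} → x ∈ ys → ∃ λ zs → length ys ≡ suc (length zs) ×
           (∀ {y} → y ∈ ys → y ≢ x → y ∈ zs)
  remove {ys = _ ∷ ys} (here refl) = ys , refl , λ { (here refl) y≢x → contradiction refl y≢x ; (there y∈) _ → y∈ }
  remove {ys = y ∷ ys} (there x∈) with remove x∈
  ... | zs , e , keep = y ∷ zs , cong suc e , λ { (here refl) _ → here refl ; (there y∈) y≢x → there (keep y∈ y≢x) }

  -- Each partner is removed from `ys` once used. A relation replaces a function because the design
  -- attached to an assignment is built from a membership proof.
  matching-length : {B : Set} (R : B → A → Set) → (∀ {x x′ y} → R x y → R x′ y → x ≡ x′) →
    {xs : List B} {ys : List A} → Unique xs → (∀ {x} → x ∈ xs → ∃ λ y → y ∈ ys × R x y) → length xs ≤ length ys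
  matching-length R inj {[]} _ _ = z≤n
  matching-length R inj {x ∷ xs} (x∉ ∷ u) partner =
    let y , y∈ , Rxy = partner (here refl)
        zs , e , keep = remove y∈
    in subst (suc (length xs) ≤_) (sym e) (s≤s (matching-length R inj u λ x′∈ →
         let y′ , y′∈ , Rx′y′ = partner (there x′∈) in
         y′ , keep y′∈ (λ e → All.lookup x∉ x′∈ (inj Rxy (subst (R _) e Rx′y′))) , Rx′y′))

  unique-⊆-length : {xs ys : List A} → Unique xs → (∀ {x} → x ∈ xs → x ∈ ys) → length xs ≤ length ys
  unique-⊆-length u xs⊆ys = matching-length _≡_ (λ { refl refl → refl }) u (λ {x} x∈ → x , xs⊆ys x∈ , refl)

  length-filter-¬ : {P : A → Set} (P? : Decidable P) (xs : List A) →
    length xs ≡ length (filter P? xs) + length (filter (¬? ∘ P?) xs)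
  length-filter-¬ P? [] = refl
  length-filter-¬ P? (x ∷ xs) with P? x
  ... | yes _ = cong suc (length-filter-¬ P? xs)
  ... | no  _ = trans (cong suc (length-filter-¬ P? xs)) (sym (ℕ.+-suc _ _))

  unique-map : {B : Set} (f : A → B) {xs : List A} → Unique xs →
    (∀ {x y} → x ∈ xs → y ∈ xs → f x ≡ f y → x ≡ y) → Unique (map f xs)
  unique-map f [] _ = []
  unique-map f (x∉ ∷ u) inj =
    All.map⁺ (All.tabulate λ y∈ e → All.lookup x∉ y∈ (inj (here refl) (there y∈) e)) ∷
    unique-map f u (λ x∈ y∈ → inj (there x∈) (there y∈))

  unique-concatMap : {B : Set} (g : A → List B) {xs : List A} → Unique xs → (∀ x → Unique (g x)) →
    (∀ {x x′ y} → y ∈ g x → y ∈ g x′ → x ≡ x′) → Unique (concatMap g xs)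
  unique-concatMap g [] _ _ = []
  unique-concatMap g {x ∷ xs} (x∉ ∷ u) ug disj = Unique.++⁺ (ug x) (unique-concatMap g u ug disj) λ (y∈ , y∈′) →
    let x′ , x′∈ , y∈gx′ = find (∈.∈-concatMap⁻ g y∈′) in All.lookup x∉ x′∈ (disj y∈ y∈gx′)

  length-concatMap-≥ : {B : Set} (g : A → List B) (n : ℕ) (xs : List A) → (∀ x → n ≤ length (g x)) →
    n * length xs ≤ length (concatMap g xs)
  length-concatMap-≥ g n [] _ = ℕ.≤-reflexive (ℕ.*-zeroʳ n)
  length-concatMap-≥ g n (x ∷ xs) n≤ = begin
    n * suc (length xs)                    ≡⟨ ℕ.*-suc n (length xs) ⟩
    n + n * length xs                      ≤⟨ ℕ.+-mono-≤ (n≤ x) (length-concatMap-≥ g n xs n≤) ⟩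
    length (g x) + length (concatMap g xs) ≡⟨ List.length-++ (g x) ⟨
    length (concatMap g (x ∷ xs))          ∎
    where open ℕ.≤-Reasoning

  length-cartesianProductWith : {B C : Set} (f : A → B → C) (xs : List A) (ys : List B) →
    length (cartesianProductWith f xs ys) ≡ length xs * length ys
  length-cartesianProductWith f [] ys = refl
  length-cartesianProductWith f (x ∷ xs) ys = trans (List.length-++ (map (f x) ys))
    (cong₂ _+_ (List.length-map (f x) ys) (length-cartesianProductWith f xs ys))

∈-allSubsets : ∀ {v} (S : Vec Bool v) → S ∈ allSubsets v
∈-allSubsets [] = here refl
∈-allSubsets {suc v} (false ∷ S) = ∈.∈-++⁺ˡ (∈.∈-map⁺ (false ∷_) (∈-allSubsets S))
∈-allSubsets {suc v} (true  ∷ S) = ∈.∈-++⁺ʳ (map (false ∷_) (allSubsets v)) (∈.∈-map⁺ (true ∷_) (∈-allSubsets S))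

allSubsets-unique : ∀ v → Unique (allSubsets v)
allSubsets-unique zero    = [] ∷ []
allSubsets-unique (suc v) = Unique.++⁺
  (Unique.map⁺ (λ { refl → refl }) (allSubsets-unique v)) (Unique.map⁺ (λ { refl → refl }) (allSubsets-unique v))
  λ (S∈ , S∈′) → disjoint (∈.∈-map⁻ _ S∈) (∈.∈-map⁻ _ S∈′)
  where
  disjoint : ∀ {S : Vec Bool (suc v)} {xs ys : List (Vec Bool v)} → (∃ λ x → x ∈ xs × S ≡ false ∷ x) →
             (∃ λ y → y ∈ ys × S ≡ true ∷ y) → ⊥
  disjoint (_ , _ , refl) (_ , _ , ())

length-allSubsets : ∀ v → length (allSubsets v) ≡ 2 ^ v
length-allSubsets zero    = refl
length-allSubsets (suc v) = trans (List.length-++ (map (false ∷_) (allSubsets v)))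
  (cong₂ _+_ (trans (List.length-map _ (allSubsets v)) (length-allSubsets v))
             (trans (trans (List.length-map _ (allSubsets v)) (length-allSubsets v)) (sym (ℕ.+-identityʳ _))))

-- Flips given by lists of disjoint subcubes

Triple : ℕ → Set
Triple h = Vec Bool h × Vec Bool h × Vec Bool h

Entry : ℕ → Set
Entry h = Triple h × Vec Bool h

_≟ⱽ_ : ∀ {h} → DecidableEquality (Vec Bool h)
_≟ⱽ_ = Vec.≡-dec Bool._≟_

_≟ᵀ_ : ∀ {h} → DecidableEquality (Triple h)
_≟ᵀ_ = Product.≡-dec _≟ⱽ_ (Product.≡-dec _≟ⱽ_ _≟ⱽ_)

addIf : ∀ {h} → Bool → Vec Bool h → Vec Bool h → Vec Bool h
addIf false x v = x
addIf true  x v = x ⊕ v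

addIf-not : ∀ {h} ε (x v : Vec Bool h) → addIf (not ε) x v ≡ addIf ε x v ⊕ v
addIf-not false x v = refl
addIf-not true  x v = sym (⊕-cancel x v)

-- The entry (p , v) stands for the subcube p + {0,v}³. Its vertices are separated by the leading
-- bit ε of the coordinates in ℤ₂ × ℤ₂ʰ, hence two entries conflict only at equal ε.
cell : ∀ {h} → Bool × Bool × Bool → Entry h → Triple h
cell (a , b , c) ((x , y , z) , v) = addIf a x v , addIf b y v , addIf c z v

NoConflict : ∀ {h} → Entry h → Entry h → Set
NoConflict e e′ = ∀ ε → cell ε e ≢ cell ε e′

Conflictfree : ∀ {h} → List (Entry h) → Set
Conflictfree = AllPairs NoConflict

conflictfree-≡ : ∀ {h} {f : List (Entry h)} {e e′} → Conflictfree f → e ∈ f → e′ ∈ f →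
  ∀ ε → cell ε e ≡ cell ε e′ → e ≡ e′
conflictfree-≡ _ (here refl) (here refl) ε _ = refl
conflictfree-≡ (n ∷ _) (here refl) (there e′∈) ε eq = contradiction eq (All.lookup n e′∈ ε)
conflictfree-≡ (n ∷ _) (there e∈) (here refl) ε eq = contradiction (sym eq) (All.lookup n e∈ ε)
conflictfree-≡ (_ ∷ c) (there e∈) (there e′∈) ε eq = conflictfree-≡ c e∈ e′∈ ε eq

contains? : ∀ {h} ε t (f : List (Entry h)) → Dec (Any (λ e → cell ε e ≡ t) f)
contains? ε t = Any.any? λ e → cell ε e ≟ᵀ t

module FlipOf {h : ℕ} (f : List (Entry h)) (cf : Conflictfree f) where

  V : Set
  V = Vec Bool (suc h)

  direction : ∀ ε t → Dec (Any (λ e → cell ε e ≡ t) f) → V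
  -- The bit `true` completes the direction: the two values `ε ∷ addIf ε x v` of a coordinate differ
  -- by `true ∷ v`.
  direction _ _ (yes e) = true ∷ proj₂ (proj₁ (find e))
  direction _ _ (no  _) = zeros

  Δ : V → V → V → V
  Δ (a ∷ x) (b ∷ y) (c ∷ z) = direction (a , b , c) (x , y , z) (contains? (a , b , c) (x , y , z) f)

  Δ-hit : ∀ {e} → e ∈ f → ∀ a b c {x y z} → cell (a , b , c) e ≡ (x , y , z) →
          Δ (a ∷ x) (b ∷ y) (c ∷ z) ≡ true ∷ proj₂ e
  Δ-hit e∈ a b c {x} {y} {z} eq with contains? (a , b , c) (x , y , z) f
  ... | no  ∄e = contradiction (lose e∈ eq) ∄e
  ... | yes ∃e with find ∃e
  ... | e′ , e′∈ , eq′ = cong (λ e → true ∷ proj₂ e) (conflictfree-≡ cf e′∈ e∈ (a , b , c) (trans eq′ (sym eq)))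

  data View : V → V → V → Set where
    hit  : ∀ {p q r v} → ((p , q , r) , v) ∈ f → ∀ a b c → View (a ∷ addIf a p v) (b ∷ addIf b q v) (c ∷ addIf c r v)
    miss : ∀ {x y z} → Δ x y z ≡ zeros → View x y z

  view : ∀ x y z → View x y z
  view (a ∷ x) (b ∷ y) (c ∷ z) with contains? (a , b , c) (x , y , z) f in eq
  ... | no _ = miss (cong (direction (a , b , c) (x , y , z)) eq)
  ... | yes ∃e with find ∃e
  ... | e , e∈ , refl = hit e∈ a b c

  flipBit : ∀ ε (x v : Vec Bool h) → (ε ∷ addIf ε x v) ⊕ (true ∷ v) ≡ not ε ∷ addIf (not ε) x v
  flipBit ε x v = cong₂ _∷_ (Bool.xor-comm ε true) (sym (addIf-not ε x v))

  -- This serves both cases of `View`: on a subcube, `d` leads to the neighbouring vertex, where the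
  -- shift is the same; elsewhere `d` is zero and nothing moves.
  invariant : ∀ {d : V} (g : V → V) x x′ → x ⊕ d ≡ x′ → g x ≡ d → g x′ ≡ d → g (x ⊕ g x) ≡ g x
  invariant g x x′ e gx gx′ = trans (cong (λ u → g (x ⊕ u)) gx) (trans (cong g e) (trans gx′ (sym gx)))

  Δ-x : ∀ x y z → Δ (x ⊕ Δ x y z) y z ≡ Δ x y z
  Δ-x x y z with view x y z
  ... | miss e = invariant (λ x → Δ x y z) x x (⊕-zeros x) e e
  ... | hit {p} {_} {_} {v} e∈ a b c = invariant (λ x → Δ x y z) x _ (flipBit a p v)
    (Δ-hit e∈ a b c refl) (Δ-hit e∈ (not a) b c refl)

  Δ-y : ∀ x y z → Δ x (y ⊕ Δ x y z) z ≡ Δ x y z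
  Δ-y x y z with view x y z
  ... | miss e = invariant (λ y → Δ x y z) y y (⊕-zeros y) e e
  ... | hit {_} {q} {_} {v} e∈ a b c = invariant (λ y → Δ x y z) y _ (flipBit b q v)
    (Δ-hit e∈ a b c refl) (Δ-hit e∈ a (not b) c refl)

  Δ-z : ∀ x y z → Δ x y (z ⊕ Δ x y z) ≡ Δ x y z
  Δ-z x y z with view x y z
  ... | miss e = invariant (λ z → Δ x y z) z z (⊕-zeros z) e e
  ... | hit {_} {_} {r} {v} e∈ a b c = invariant (λ z → Δ x y z) z _ (flipBit c r v)
    (Δ-hit e∈ a b c refl) (Δ-hit e∈ a b (not c) refl)

  flip : Flip (suc h)
  flip = record { Δ = Δ ; Δ-x = Δ-x ; Δ-y = Δ-y ; Δ-z = Δ-z }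

entries-≡ : ∀ {h} (f f′ : List (Entry h)) → map proj₁ f ≡ map proj₁ f′ →
  (∀ {p v v′} → (p , v) ∈ f → (p , v′) ∈ f′ → v ≡ v′) → f ≡ f′
entries-≡ [] [] _ _ = refl
entries-≡ ((p , v) ∷ f) ((p′ , v′) ∷ f′) eq same with refl ← List.∷-injectiveˡ eq =
  cong₂ (λ v f → (p , v) ∷ f) (same (here refl) (here refl))
    (entries-≡ f f′ (List.∷-injectiveʳ eq) (λ e∈ e′∈ → same (there e∈) (there e′∈)))

-- The direction of each subcube is read off at its vertex with leading bits `false`, whose position
-- is the common key.
flip-determines : ∀ {h} (f f′ : List (Entry h)) (cf : Conflictfree f) (cf′ : Conflictfree f′) →
  map proj₁ f ≡ map proj₁ f′ →
  (∀ x y z → FlipOf.Δ f cf x y z ≡ FlipOf.Δ f′ cf′ x y z) → f ≡ f′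
flip-determines f f′ cf cf′ keys same = entries-≡ f f′ keys λ {(x , y , z)} {v} {v′} e∈ e′∈ → Vec.∷-injectiveʳ (begin
  true ∷ v                                                 ≡⟨ FlipOf.Δ-hit f cf e∈ false false false refl ⟨
  FlipOf.Δ f cf (false ∷ x) (false ∷ y) (false ∷ z)        ≡⟨ same (false ∷ x) (false ∷ y) (false ∷ z) ⟩
  FlipOf.Δ f′ cf′ (false ∷ x) (false ∷ y) (false ∷ z)      ≡⟨ FlipOf.Δ-hit f′ cf′ e′∈ false false false refl ⟩
  true ∷ v′                                                ∎)
  where open ≡-Reasoning

-- Greedy choice of directions

module Greedy (k : ℕ) where

  -- ℤ₂ᵏ as a subgroup of index 16, so that the 7·2ᵏ directions excluded at a
  -- point leave more than half of all directions.
  H : ℕ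
  H = 4 + k

  ι : Vec Bool k → Vec Bool H
  ι x = false ∷ false ∷ false ∷ false ∷ x

  ι³ : Triple k → Triple H
  ι³ (x , y , z) = ι x , ι y , ι z

  ι³-inj : Injection ι³
  ι³-inj refl = refl

  valueAt : ∀ {p} {f : List (Entry H)} → Dec (Any (λ e → proj₁ e ≡ p) f) → Vec Bool H
  valueAt (yes e) = proj₂ (proj₁ (find e))
  -- The default can only forbid directions needlessly; the bound on `forbidden` counts them anyway.
  valueAt (no  _) = zeros

  value : List (Entry H) → Triple H → Vec Bool H
  value f p = valueAt (Any.any? (λ e → proj₁ e ≟ᵀ p) f)

  value-correct : ∀ {f p v} → Conflictfree f → (p , v) ∈ f → value f p ≡ v
  value-correct {f} {p} cf e∈ with Any.any? (λ e → proj₁ e ≟ᵀ p) f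
  ... | no ∄e = contradiction (lose e∈ refl) ∄e
  ... | yes ∃e with find ∃e
  ... | e′ , e′∈ , eq = cong proj₂ (conflictfree-≡ cf e′∈ e∈ (false , false , false) eq)

  nonzero : List (Bool × Bool × Bool)
  nonzero = (true , false , false) ∷ (false , true , false) ∷ (false , false , true) ∷ (true , true , false)
          ∷ (true , false , true) ∷ (false , true , true) ∷ (true , true , true) ∷ []

  -- If direction v at p meets direction w at q in the vertices `ε`, then v + w = `ι d` for some d
  -- and q = `cell ε (p , ι d)`. So `ε` and d determine q, then w, then the single direction v = w +
  -- `ι d`.
  clash : List (Entry H) → Triple H → Bool × Bool × Bool → Vec Bool k → Vec Bool H
  clash f p ε d = value f (cell ε (p , ι d)) ⊕ ι d

  forbidden : List (Entry H) → Triple H → List (Vec Bool H)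
  forbidden f p = cartesianProductWith (clash f p) nonzero (allSubsets k)

  allowed : List (Entry H) → Triple H → List (Vec Bool H)
  allowed f p = filter (λ v → ¬? (mem? _≟ⱽ_ v (forbidden f p))) (allSubsets H)

  length-allowed : ∀ f p → 9 * 2 ^ k ≤ length (allowed f p)
  length-allowed f p = ℕ.+-cancelˡ-≤ (7 * 2 ^ k) _ _ (begin
    7 * 2 ^ k + 9 * 2 ^ k       ≡⟨ ℕ.*-distribʳ-+ (2 ^ k) 7 9 ⟨
    16 * 2 ^ k                  ≡⟨ ℕ.^-distribˡ-+-* 2 4 k ⟨
    2 ^ H                       ≡⟨ length-allSubsets H ⟨
    length (allSubsets H)       ≡⟨ length-filter-¬ (λ v → mem? _≟ⱽ_ v (forbidden f p)) (allSubsets H) ⟩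
    length bad + length (allowed f p) ≤⟨ ℕ.+-monoˡ-≤ _ bad≤ ⟩
    7 * 2 ^ k + length (allowed f p) ∎)
    where
    open ℕ.≤-Reasoning
    bad = filter (λ v → mem? _≟ⱽ_ v (forbidden f p)) (allSubsets H)
    bad≤ : length bad ≤ 7 * 2 ^ k
    bad≤ = begin
      length bad               ≤⟨ unique-⊆-length (Unique.filter⁺ _ (allSubsets-unique H))
                                    (λ v∈ → proj₂ (∈.∈-filter⁻ (λ v → mem? _≟ⱽ_ v (forbidden f p))
                                      {xs = allSubsets H} v∈)) ⟩
      length (forbidden f p)   ≡⟨ length-cartesianProductWith (clash f p) nonzero (allSubsets k) ⟩
      7 * length (allSubsets k) ≡⟨ cong (7 *_) (length-allSubsets k) ⟩
      7 * 2 ^ k                ∎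

  extend : Triple k → List (Entry H) → List (List (Entry H))
  extend p f = map (λ v → (ι³ p , v) ∷ f) (allowed f (ι³ p))

  assignments : List (Triple k) → List (List (Entry H))
  assignments []       = [] ∷ []
  assignments (p ∷ ps) = concatMap (extend p) (assignments ps)

  length-assignments : ∀ ps → (9 * 2 ^ k) ^ length ps ≤ length (assignments ps)
  length-assignments []       = ℕ.≤-refl
  length-assignments (p ∷ ps) = ℕ.≤-trans (ℕ.*-monoʳ-≤ (9 * 2 ^ k) (length-assignments ps))
    (length-concatMap-≥ (extend p) (9 * 2 ^ k) (assignments ps) λ f →
      ℕ.≤-trans (length-allowed f (ι³ p)) (ℕ.≤-reflexive (sym (List.length-map _ (allowed f (ι³ p))))))

  assignments-unique : ∀ ps → Unique (assignments ps)
  assignments-unique []       = [] ∷ []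
  assignments-unique (p ∷ ps) = unique-concatMap (extend p) (assignments-unique ps)
    (λ f → Unique.map⁺ (λ { refl → refl }) (Unique.filter⁺ _ (allSubsets-unique H)))
    (λ y∈ y∈′ → tails (∈.∈-map⁻ _ y∈) (∈.∈-map⁻ _ y∈′))
    where
    tails : ∀ {f f′ g} {A B : Vec Bool H → Set} → (∃ λ v → A v × g ≡ (ι³ p , v) ∷ f) →
            (∃ λ v → B v × g ≡ (ι³ p , v) ∷ f′) → f ≡ f′
    tails (_ , _ , refl) (_ , _ , refl) = refl

  Extends : Triple k → List (List (Entry H)) → List (Entry H) → Set
  Extends p fs g = ∃ λ f → f ∈ fs × ∃ λ v → v ∈ allowed f (ι³ p) × g ≡ (ι³ p , v) ∷ f

  assignments-∷ : ∀ p ps {g} → g ∈ assignments (p ∷ ps) → Extends p (assignments ps) g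
  assignments-∷ p ps g∈ = let f , f∈ , g∈′ = find (∈.∈-concatMap⁻ (extend p) {xs = assignments ps} g∈) in
    f , f∈ , ∈.∈-map⁻ _ g∈′

  keys : ∀ ps {f} → f ∈ assignments ps → map proj₁ f ≡ map ι³ ps
  keys []       (here refl) = refl
  keys (p ∷ ps) g∈ = step (assignments-∷ p ps g∈)
    where
    step : ∀ {g} → Extends p (assignments ps) g → map proj₁ g ≡ ι³ p ∷ map ι³ ps
    step (f , f∈ , v , _ , refl) = cong (ι³ p ∷_) (keys ps f∈)

  ∈-nonzero : ∀ ε → ε ≡ (false , false , false) ⊎ ε ∈ nonzero
  ∈-nonzero (false , false , false) = inj₁ refl
  ∈-nonzero (true  , false , false) = inj₂ (here refl)
  ∈-nonzero (false , true  , false) = inj₂ (there (here refl))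
  ∈-nonzero (false , false , true ) = inj₂ (there (there (here refl)))
  ∈-nonzero (true  , true  , false) = inj₂ (there (there (there (here refl))))
  ∈-nonzero (true  , false , true ) = inj₂ (there (there (there (there (here refl)))))
  ∈-nonzero (false , true  , true ) = inj₂ (there (there (there (there (there (here refl))))))
  ∈-nonzero (true  , true  , true ) = inj₂ (there (there (there (there (there (there (here refl)))))))

  exchange : ∀ {h} (x v y w : Vec Bool h) → x ⊕ v ≡ y ⊕ w → v ⊕ w ≡ x ⊕ y
  exchange x v y w e = begin
    v ⊕ w               ≡⟨ cong (_⊕ w) (⊕-cancel v x) ⟨
    ((v ⊕ x) ⊕ x) ⊕ w   ≡⟨ cong (λ u → (u ⊕ x) ⊕ w) (trans (⊕-comm v x) e) ⟩
    ((y ⊕ w) ⊕ x) ⊕ w   ≡⟨ ⊕-swap (y ⊕ w) x w ⟩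
    ((y ⊕ w) ⊕ w) ⊕ x   ≡⟨ cong (_⊕ x) (⊕-cancel y w) ⟩
    y ⊕ x               ≡⟨ ⊕-comm y x ⟩
    x ⊕ y               ∎
    where open ≡-Reasoning

  addIf-exchange : ∀ {h} ε (x v y w : Vec Bool h) → addIf ε x v ≡ addIf ε y w → addIf ε x (v ⊕ w) ≡ y
  addIf-exchange false x v y w e = e
  addIf-exchange true  x v y w e = begin
    x ⊕ (v ⊕ w)   ≡⟨ ⊕-assoc x v w ⟨
    (x ⊕ v) ⊕ w   ≡⟨ cong (_⊕ w) e ⟩
    (y ⊕ w) ⊕ w   ≡⟨ ⊕-cancel y w ⟩
    y             ∎
    where open ≡-Reasoning

  cell-exchange : ∀ {h} ε (p q : Triple h) v w → cell ε (p , v) ≡ cell ε (q , w) → cell ε (p , v ⊕ w) ≡ q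
  cell-exchange (a , b , c) (x , y , z) (x′ , y′ , z′) v w e =
    cong₂ _,_ (addIf-exchange a x v x′ w (cong proj₁ e))
    (cong₂ _,_ (addIf-exchange b y v y′ w (cong (proj₁ ∘ proj₂) e))
               (addIf-exchange c z v z′ w (cong (proj₂ ∘ proj₂) e)))

  -- The difference of two clashing directions is a difference of coordinates
  -- of the two points, hence lies in the subgroup.
  clash-difference : ∀ {ε} → ε ∈ nonzero → ∀ (p q : Triple k) v w → cell ε (ι³ p , v) ≡ cell ε (ι³ q , w) →
    ∃ λ d → v ⊕ w ≡ ι d
  clash-difference {true , _ , _} _ (x , y , z) (x′ , y′ , z′) v w e =
    x ⊕ x′ , exchange (ι x) v (ι x′) w (cong proj₁ e)
  clash-difference {false , true , _} _ (x , y , z) (x′ , y′ , z′) v w e =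
    y ⊕ y′ , exchange (ι y) v (ι y′) w (cong (proj₁ ∘ proj₂) e)
  clash-difference {false , false , true} _ (x , y , z) (x′ , y′ , z′) v w e =
    z ⊕ z′ , exchange (ι z) v (ι z′) w (cong (proj₂ ∘ proj₂) e)
  clash-difference {false , false , false} (there (there (there (there (there (there (there ()))))))) _ _ _ _ _

  clash-forbidden : ∀ {f p q v w ε} → Conflictfree f → (ι³ q , w) ∈ f → ε ∈ nonzero →
    cell ε (ι³ p , v) ≡ cell ε (ι³ q , w) → v ∈ forbidden f (ι³ p)
  clash-forbidden {f} {p} {q} {v} {w} {ε} cf q∈ ε∈ e with clash-difference ε∈ p q v w e
  ... | d , v⊕w≡ιd = subst (_∈ forbidden f (ι³ p)) clash≡v
          (∈.∈-cartesianProductWith⁺ (clash f (ι³ p)) ε∈ (∈-allSubsets d))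
    where
    open ≡-Reasoning
    clash≡v : clash f (ι³ p) ε d ≡ v
    clash≡v = begin
      value f (cell ε (ι³ p , ι d)) ⊕ ι d     ≡⟨ cong (λ u → value f (cell ε (ι³ p , u)) ⊕ u) v⊕w≡ιd ⟨
      value f (cell ε (ι³ p , v ⊕ w)) ⊕ (v ⊕ w) ≡⟨ cong (λ t → value f t ⊕ (v ⊕ w)) (cell-exchange ε (ι³ p) (ι³ q) v w e) ⟩
      value f (ι³ q) ⊕ (v ⊕ w)                ≡⟨ cong (_⊕ (v ⊕ w)) (value-correct cf q∈) ⟩
      w ⊕ (v ⊕ w)                             ≡⟨ ⊕-comm w (v ⊕ w) ⟩
      (v ⊕ w) ⊕ w                             ≡⟨ ⊕-cancel v w ⟩
      v                                       ∎

  -- Avoiding `forbidden` handles the seven nonzero `ε`. At the remaining one the vertices are the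
  -- positions themselves, which are distinct.
  extend-conflictfree : ∀ {p ps f v} → All (p ≢_) ps → Conflictfree f → map proj₁ f ≡ map ι³ ps →
    v ∉ forbidden f (ι³ p) → Conflictfree ((ι³ p , v) ∷ f)
  extend-conflictfree {p} {ps} {f} {v} p∉ cf keys-f v∉ = All.tabulate noConflict ∷ cf
    where
    noConflict : ∀ {e} → e ∈ f → NoConflict (ι³ p , v) e
    noConflict {q′ , w} e∈ ε eq
      with ∈.∈-map⁻ ι³ (subst (q′ ∈_) keys-f (∈.∈-map⁺ proj₁ e∈)) | ∈-nonzero ε
    ... | q , q∈ , refl | inj₁ refl = All.lookup p∉ q∈ (ι³-inj eq)
    ... | q , q∈ , refl | inj₂ ε∈   = v∉ (clash-forbidden cf e∈ ε∈ eq)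

  conflictfree : ∀ ps {f} → Unique ps → f ∈ assignments ps → Conflictfree f
  conflictfree []       _ (here refl) = []
  conflictfree (p ∷ ps) (p∉ ∷ u) g∈ = step (assignments-∷ p ps g∈)
    where
    step : ∀ {g} → Extends p (assignments ps) g → Conflictfree g
    step (f , f∈ , v , v∈ , refl) = extend-conflictfree p∉ (conflictfree ps u f∈) (keys ps f∈)
      (proj₂ (∈.∈-filter⁻ (λ v → ¬? (mem? _≟ⱽ_ v (forbidden f (ι³ p)))) {xs = allSubsets H} v∈))

  positions : List (Triple k)
  positions = cartesianProduct (allSubsets k) (cartesianProduct (allSubsets k) (allSubsets k))

  positions-unique : Unique positions
  positions-unique = Unique.cartesianProduct⁺ (allSubsets-unique k)
    (Unique.cartesianProduct⁺ (allSubsets-unique k) (allSubsets-unique k))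

  length-positions : length positions ≡ (2 ^ k) ^ 3
  length-positions = begin
    length positions  ≡⟨ length-cartesianProductWith _,_ A (cartesianProduct A A) ⟩
    length A * length (cartesianProduct A A) ≡⟨ cong (length A *_) (length-cartesianProductWith _,_ A A) ⟩
    length A * (length A * length A) ≡⟨ cong (λ n → n * (n * n)) (length-allSubsets k) ⟩
    2 ^ k * (2 ^ k * 2 ^ k) ≡⟨ cong (λ n → 2 ^ k * (2 ^ k * n)) (ℕ.*-identityʳ (2 ^ k)) ⟨
    (2 ^ k) ^ 3 ∎
    where
    open ≡-Reasoning
    A = allSubsets k

-- From designs to families of subsets

insert-∣∣ : ∀ {v} (S : Subset v) x → x ∉ˢ S → ∣ S [ x ]≔ inside ∣ ≡ suc ∣ S ∣
insert-∣∣ (inside  ∷ S) zero    x∉ = contradiction here x∉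
insert-∣∣ (outside ∷ S) zero    x∉ = refl
insert-∣∣ (inside  ∷ S) (suc x) x∉ = cong suc (insert-∣∣ S x (x∉ ∘ there))
insert-∣∣ (outside ∷ S) (suc x) x∉ = insert-∣∣ S x (x∉ ∘ there)

insert⁻ : ∀ {v} (S : Subset v) x {y} → y ∈ˢ (S [ x ]≔ inside) → x ≡ y ⊎ y ∈ˢ S
insert⁻ (_ ∷ S) zero    here       = inj₁ refl
insert⁻ (_ ∷ S) zero    (there y∈) = inj₂ (there y∈)
insert⁻ (_ ∷ S) (suc x) here       = inj₂ here
insert⁻ (_ ∷ S) (suc x) (there y∈) with insert⁻ S x y∈
... | inj₁ refl = inj₁ refl
... | inj₂ y∈S  = inj₂ (there y∈S)

insert⁺ : ∀ {v} (S : Subset v) x {y} → y ∈ˢ S → y ∈ˢ (S [ x ]≔ inside)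
insert⁺ (_ ∷ S) zero    here       = here
insert⁺ (_ ∷ S) zero    (there y∈) = there y∈
insert⁺ (_ ∷ S) (suc x) here       = here
insert⁺ (_ ∷ S) (suc x) (there y∈) = there (insert⁺ S x y∈)

image : ∀ {m v} → (Fin m → Fin v) → Subset v
image {zero}  g = Subset.⊥
image {suc m} g = image (g ∘ suc) [ g zero ]≔ inside

image⁺ : ∀ {m v} {g : Fin m → Fin v} {y} → y ∈ᶠ g → y ∈ˢ image g
image⁺ {g = g} (zero  , refl) = Vec.[]≔-updates (image (g ∘ suc)) (g zero)
image⁺ {g = g} (suc i , e)    = insert⁺ _ (g zero) (image⁺ (i , e))

image⁻ : ∀ {m v} {g : Fin m → Fin v} {y} → y ∈ˢ image g → y ∈ᶠ g
image⁻ {zero}      y∈ = contradiction y∈ Subset.∉⊥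
image⁻ {suc m} {g = g} y∈ with insert⁻ _ (g zero) y∈
... | inj₁ e = zero , e
... | inj₂ y∈′ = let i , e = image⁻ y∈′ in suc i , e

∣image∣ : ∀ {m v} {g : Fin m → Fin v} → Injection g → ∣ image g ∣ ≡ m
∣image∣ {zero}  {v} inj = Subset.∣⊥∣≡0 v
∣image∣ {suc m} {g = g} inj = trans
  (insert-∣∣ (image (g ∘ suc)) (g zero) λ g0∈ → let i , e = image⁻ {g = g ∘ suc} g0∈ in Fin.0≢1+n (sym (inj e)))
  (cong suc (∣image∣ {g = g ∘ suc} (Fin.suc-injective ∘ inj)))

Through-image : ∀ {v} → Fin v → Fin v → Fin v → Subset v → Set
Through-image x y z S = x ∈ˢ S × y ∈ˢ S × z ∈ˢ S

peel : ∀ {v n} (S : Subset v) → ∣ S ∣ ≡ suc n → ∃₂ λ x S′ →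
  x ∈ˢ S × x ∉ˢ S′ × ∣ S′ ∣ ≡ n × S′ ⊆ˢ S × (∀ {y} → y ∈ˢ S → y ≡ x ⊎ y ∈ˢ S′)
peel (inside ∷ S) e = zero , outside ∷ S , here , (λ ()) , ℕ.suc-injective e , (λ { (there y∈) → there y∈ }) ,
  λ { here → inj₁ refl ; (there y∈) → inj₂ (there y∈) }
peel (outside ∷ S) e with peel S e
... | x , S′ , x∈ , x∉ , e′ , ⊆S , cover = suc x , outside ∷ S′ , there x∈ , (λ { (there x∈) → x∉ x∈ }) , e′ ,
  (λ { (there y∈) → there (⊆S y∈) }) , λ { (there y∈) → Sum.map (cong suc) there (cover y∈) }

∣∣≡0⇒∉ : ∀ {v} {S : Subset v} {x} → ∣ S ∣ ≡ 0 → x ∉ˢ S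
∣∣≡0⇒∉ {S = inside  ∷ _} () _
∣∣≡0⇒∉ {S = outside ∷ _} e (there x∈) = ∣∣≡0⇒∉ e x∈

threeElements : ∀ {v} (S : Subset v) → ∣ S ∣ ≡ 3 → ∃ λ x → ∃₂ λ y z → Distinct x y z × Through-image x y z S ×
  (∀ {B} → Through-image x y z B → S ⊆ˢ B)
threeElements S e with peel S e
... | x , S₁ , x∈ , x∉ , e₁ , ⊆₁ , cover₁ with peel S₁ e₁
... | y , S₂ , y∈ , y∉ , e₂ , ⊆₂ , cover₂ with peel S₂ e₂
... | z , S₃ , z∈ , z∉ , e₃ , ⊆₃ , cover₃ = x , y , z ,
    ((λ { refl → x∉ y∈ }) , (λ { refl → x∉ (⊆₂ z∈) }) , (λ { refl → y∉ z∈ })) ,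
    (x∈ , ⊆₁ y∈ , ⊆₁ (⊆₂ z∈)) , inside-B
  where
  inside-B : ∀ {B} → Through-image x y z B → S ⊆ˢ B
  inside-B (x∈B , y∈B , z∈B) p∈ with cover₁ p∈
  ... | inj₁ refl = x∈B
  ... | inj₂ p∈₁ with cover₂ p∈₁
  ... | inj₁ refl = y∈B
  ... | inj₂ p∈₂ with cover₃ p∈₂
  ... | inj₁ refl = z∈B
  ... | inj₂ p∈₃ = contradiction p∈₃ (∣∣≡0⇒∉ e₃)

filter-∈-sublists : {A : Set} {P : A → Set} (P? : Decidable P) (xs : List A) → filter P? xs ∈ sublists xs
filter-∈-sublists P? [] = here refl
filter-∈-sublists P? (x ∷ xs) with P? x
... | yes _ = ∈.∈-++⁺ʳ (sublists xs) (∈.∈-map⁺ (x ∷_) (filter-∈-sublists P? xs))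
... | no  _ = ∈.∈-++⁺ˡ (filter-∈-sublists P? xs)

T-and : {A : Set} (f : A → Bool) (xs : List A) → (∀ {x} → x ∈ xs → T (f x)) → T (and (map f xs))
T-and f []       _ = tt
T-and f (x ∷ xs) t = Equivalence.from Bool.T-∧ (t (here refl) , T-and f xs (t ∘ there))

length-filter-none : {A : Set} {P : A → Set} (P? : Decidable P) (xs : List A) → (∀ {x} → x ∈ xs → ¬ P x) →
  length (filter P? xs) ≡ 0
length-filter-none P? [] _ = refl
length-filter-none P? (x ∷ xs) ¬p with P? x
... | yes p = contradiction p (¬p (here refl))
... | no  _ = length-filter-none P? xs (¬p ∘ there)

length-filter-one : {A : Set} {P : A → Set} (P? : Decidable P) {xs : List A} {a : A} → Unique xs → a ∈ xs → P a →
  (∀ {x} → x ∈ xs → P x → x ≡ a) → length (filter P? xs) ≡ 1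
length-filter-one P? {x ∷ xs} (x∉ ∷ u) a∈ pa only with P? x
length-filter-one P? {x ∷ xs} (x∉ ∷ u) a∈ pa only | yes p = cong suc (length-filter-none P? xs λ y∈ py →
  All.lookup x∉ y∈ (trans (only (here refl) p) (sym (only (there y∈) py))))
length-filter-one P? {x ∷ xs} (x∉ ∷ u) (here refl) pa only | no ¬p = contradiction pa ¬p
length-filter-one P? {x ∷ xs} (x∉ ∷ u) (there a∈) pa only | no ¬p = length-filter-one P? u a∈ pa (only ∘ there)

-- A design as a function from triples to blocks; `closed` encodes uniqueness. Filtering
-- `allSubsets` makes `family` a canonical list, so it depends only on the set of blocks.
record System (v : ℕ) : Set where
  field
    block    : Fin v → Fin v → Fin v → Subset v
    size-4-6 : ∀ {x y z} → Distinct x y z → ∣ block x y z ∣ ≡ 4 ⊎ ∣ block x y z ∣ ≡ 6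
    contains : ∀ {x y z} → Distinct x y z → Through-image x y z (block x y z)
    closed   : ∀ {x y z x′ y′ z′} → Distinct x y z → Distinct x′ y′ z′ →
               Through-image x′ y′ z′ (block x y z) → block x′ y′ z′ ≡ block x y z

  IsBlock : Subset v → Set
  IsBlock S = ∃ λ x → ∃₂ λ y z → Distinct x y z × S ≡ block x y z

  isBlock? : Decidable IsBlock
  isBlock? S = Fin.any? λ x → Fin.any? λ y → Fin.any? λ z →
    distinct? Fin._≟_ x y z ×-dec Vec.≡-dec Bool._≟_ S (block x y z)

  family : List (Subset v)
  family = filter isBlock? (allSubsets v)

  ∈-family⁺ : ∀ {S} → IsBlock S → S ∈ family
  ∈-family⁺ {S} b = ∈.∈-filter⁺ isBlock? (∈-allSubsets S) b

  ∈-family⁻ : ∀ {S} → S ∈ family → IsBlock S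
  ∈-family⁻ S∈ = proj₂ (∈.∈-filter⁻ isBlock? {xs = allSubsets v} S∈)

  block-determined : ∀ {x y z S} → Distinct x y z → Through-image x y z S → S ∈ family → S ≡ block x y z
  block-determined d th S∈ with ∈-family⁻ S∈
  ... | _ , _ , _ , d′ , refl = sym (closed d′ d th)

  goodSize : ∀ {S} → S ∈ family → T ((∣ S ∣ ≡ᵇ 4) ∨ (∣ S ∣ ≡ᵇ 6))
  goodSize {S} S∈ with ∈-family⁻ S∈
  ... | _ , _ , _ , d , refl with size-4-6 d
  ... | inj₁ e rewrite e = tt
  ... | inj₂ e rewrite e = tt

  coveredOnce : ∀ S → T (not (∣ S ∣ ≡ᵇ 3) ∨ (length (filterᵇ (λ b → ⌊ S Subset.⊆? b ⌋) family) ≡ᵇ 1))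
  coveredOnce S with ∣ S ∣ ≡ᵇ 3 in eq
  ... | false = tt
  ... | true with threeElements S (ℕ.≡ᵇ⇒≡ ∣ S ∣ 3 (subst T (sym eq) tt))
  ... | x , y , z , d , (x∈ , y∈ , z∈) , ⊆B = ℕ.≡⇒≡ᵇ _ 1 (length-filter-one _
        (Unique.filter⁺ isBlock? (allSubsets-unique v)) (∈-family⁺ (x , y , z , d , refl))
        (fromWitness {a? = S Subset.⊆? block x y z} (⊆B (contains d)))
        λ {B} B∈ S⊆B → let S⊆B = toWitness {a? = S Subset.⊆? B} S⊆B in block-determined d (S⊆B x∈ , S⊆B y∈ , S⊆B z∈) B∈)

  family-isDesign : T (isDesign v family)
  family-isDesign = Equivalence.from Bool.T-∧
    (T-and _ family goodSize , T-and _ (allSubsets v) (λ {S} _ → coveredOnce S))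

  family-∈ : family ∈ filterᵇ (isDesign v) (sublists (allSubsets v))
  family-∈ = ∈.∈-filter⁺ _ (filter-∈-sublists isBlock? (allSubsets v)) family-isDesign

-- The block of `A` through the triple occurs in the family of `B`, where only one block contains
-- that triple.
family-determines : ∀ {v} (A B : System v) → System.family A ≡ System.family B →
  ∀ {x y z} → Distinct x y z → System.block A x y z ≡ System.block B x y z
family-determines A B e {x} {y} {z} d = System.block-determined B d (System.contains A d)
  (subst (System.block A x y z ∈_) e (System.∈-family⁺ A (x , y , z , d , refl)))

-- Exchanging the Latin cube inside a design

othersThan : ∀ (i j l : Fin 4) → Distinct i j l →
  ∃ λ m → i ≢ m × j ≢ m × l ≢ m × (∀ i′ → i′ ≢ m → i ≡ i′ ⊎ j ≡ i′ ⊎ l ≡ i′)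
othersThan = from-yes (Fin.all? {4} λ i → Fin.all? λ j → Fin.all? λ l → distinct? Fin._≟_ i j l →-dec
  Fin.any? λ m → ¬? (i Fin.≟ m) ×-dec ¬? (j Fin.≟ m) ×-dec ¬? (l Fin.≟ m) ×-dec
  Fin.all? λ i′ → ¬? (i′ Fin.≟ m) →-dec (i Fin.≟ i′ ⊎-dec j Fin.≟ i′ ⊎-dec l Fin.≟ i′))

Searchable : Set → Set₁
Searchable A = {P : A → Set} → Decidable P → Dec (∃ P)

any-× : {A B : Set} → Searchable A → Searchable B → Searchable (A × B)
any-× anyA anyB P? = map′ (λ (a , b , p) → (a , b) , p) (λ ((a , b) , p) → a , b , p)
                          (anyA (λ a → anyB (λ b → P? (a , b))))

module Switch {v K : ℕ} (R : Boolean (Fin v) K) where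
  open Boolean R
  open Latin using (entry; L; complete; determined)

  Cell : Set
  Cell = Vec Bool K × Vec Bool K × Vec Bool K

  cellBlock : Flip K → Cell → Fin 4 → Fin v
  cellBlock F s i = point i (entry F s i)

  cellBlock-inj : ∀ F s → Injection (cellBlock F s)
  cellBlock-inj F s e = cong proj₁ (point-inj e)

  -- By `point-inj` a point knows its group, so a common point occupies the same coordinate in both
  -- cells. Agreement in three coordinates settles the fourth.
  cellBlock-unique : ∀ F {x y z} s s′ → Distinct x y z →
    Through x y z (cellBlock F s) → Through x y z (cellBlock F s′) → s ≡ s′
  cellBlock-unique F s s′ (xy , xz , yz) ((i , refl) , (j , refl) , (l , refl)) ((i′ , ei) , (j′ , ej) , (l′ , el)) =
    let m , _ , _ , _ , others = othersThan i j l
          (xy ∘ cong (cellBlock F s) , xz ∘ cong (cellBlock F s) , yz ∘ cong (cellBlock F s))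
    in determined F m s s′ λ c c≢m → agree c (others c c≢m)
    where
    same : ∀ i i′ → cellBlock F s′ i′ ≡ cellBlock F s i → entry F s i ≡ entry F s′ i
    same i i′ e with refl ← cong proj₁ (point-inj e) = sym (cong proj₂ (point-inj e))
    agree : ∀ c → i ≡ c ⊎ j ≡ c ⊎ l ≡ c → entry F s c ≡ entry F s′ c
    agree c (inj₁ refl)        = same i i′ ei
    agree c (inj₂ (inj₁ refl)) = same j j′ ej
    agree c (inj₂ (inj₂ refl)) = same l l′ el

  -- Three distinct points of a cell fix three coordinates, and these can be completed to a cell of
  -- any other Latin cube.
  switch : ∀ F F′ s {x y z} → Distinct x y z → Through x y z (cellBlock F s) → ∃ λ s′ → Through x y z (cellBlock F′ s′)
  switch F F′ s (xy , xz , yz) ((i , refl) , (j , refl) , (l , refl)) =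
    let m , i≢m , j≢m , l≢m , _ = othersThan i j l
          (xy ∘ cong (cellBlock F s) , xz ∘ cong (cellBlock F s) , yz ∘ cong (cellBlock F s))
        s′ , e = complete F′ m (entry F s)
    in s′ , (i , cong (point i) (e i i≢m)) , (j , cong (point j) (e j j≢m)) , (l , cong (point l) (e l l≢m))

  tblock-cell : ∀ x y z i → pts (tblock x y z) i ≡ cellBlock noFlip (x , y , z) i
  tblock-cell x y z 0F = tblock-pts x y z 0F
  tblock-cell x y z 1F = tblock-pts x y z 1F
  tblock-cell x y z 2F = tblock-pts x y z 2F
  tblock-cell x y z 3F = trans (tblock-pts x y z 3F) (cong (point 3F) (sym (⊕-zeros _)))

  through-≗ : ∀ {n x y z} {g g′ : Fin n → Fin v} → (∀ i → g i ≡ g′ i) → Through x y z g → Through x y z g′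
  through-≗ e ((i , ei) , (j , ej) , (l , el)) =
    (i , trans (sym (e i)) ei) , (j , trans (sym (e j)) ej) , (l , trans (sym (e l)) el)

  module Switched (F : Flip K) where

    onCell? : ∀ x y z → Dec (∃ λ s → Through x y z (cellBlock F s))
    onCell? x y z = any-× Subset.anySubset? (any-× Subset.anySubset? Subset.anySubset?)
      λ s → Fin.any? (λ i → cellBlock F s i Fin.≟ x) ×-dec Fin.any? (λ i → cellBlock F s i Fin.≟ y)
            ×-dec Fin.any? (λ i → cellBlock F s i Fin.≟ z)

    -- Cells take precedence over old blocks. This discards the old transversal blocks, since each
    -- of their triples lies on a cell of the new cube.
    blockOf : ∀ {x y z} → Dec (∃ λ s → Through x y z (cellBlock F s)) → Dec (Distinct x y z) → Subset v
    blockOf (yes (s , _)) _       = image (cellBlock F s)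
    blockOf (no _)        (yes d) = let _ , b , _ = cover d in image (pts b)
    -- A default for triples with repeated points, on which `System` imposes nothing.
    blockOf (no _)        (no _)  = Subset.⊥

    block : Fin v → Fin v → Fin v → Subset v
    block x y z = blockOf (onCell? x y z) (distinct? Fin._≟_ x y z)

    data View (x y z : Fin v) : Subset v → Set where
      inside  : ∀ s → Through x y z (cellBlock F s) → View x y z (image (cellBlock F s))
      outside : ∀ {κ} (b : Block κ) → ¬ (∃ λ s → Through x y z (cellBlock F s)) →
                Through x y z (pts b) → View x y z (image (pts b))

    view : ∀ {x y z} → Distinct x y z → View x y z (block x y z)
    view {x} {y} {z} d with onCell? x y z | distinct? Fin._≟_ x y z
    ... | yes (s , th) | _     = inside s th
    ... | no ∄s        | yes d = let _ , b , th = cover d in outside b ∄s th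
    ... | no _         | no ¬d = contradiction d ¬d

    image-through⁺ : ∀ {n x y z} {g : Fin n → Fin v} → Through x y z g → Through-image x y z (image g)
    image-through⁺ (x∈ , y∈ , z∈) = image⁺ x∈ , image⁺ y∈ , image⁺ z∈

    image-through⁻ : ∀ {n x y z} {g : Fin n → Fin v} → Through-image x y z (image g) → Through x y z g
    image-through⁻ (x∈ , y∈ , z∈) = image⁻ x∈ , image⁻ y∈ , image⁻ z∈

    block-size : ∀ {x y z} → Distinct x y z → ∣ block x y z ∣ ≡ 4 ⊎ ∣ block x y z ∣ ≡ 6
    block-size {x} {y} {z} d with block x y z | view d
    ... | _ | inside s _               = inj₁ (∣image∣ (cellBlock-inj F s))
    ... | _ | outside {four} b _ _ = inj₁ (∣image∣ (pts-inj b))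
    ... | _ | outside {six} b _ _  = inj₂ (∣image∣ (pts-inj b))

    block-contains : ∀ {x y z} → Distinct x y z → Through-image x y z (block x y z)
    block-contains {x} {y} {z} d with block x y z | view d
    ... | _ | inside s th    = image-through⁺ th
    ... | _ | outside b _ th = image-through⁺ th

    -- A block of the old design through three points of a new cell is itself one of the blocks
    -- that were replaced, since the old Latin cube has a cell through the same points.
    outside-cell : ∀ {x y z x′ y′ z′ κ} (b : Block κ) s → Distinct x′ y′ z′ → Through x′ y′ z′ (cellBlock F s) →
      Through x′ y′ z′ (pts b) → Distinct x y z → Through x y z (pts b) → ∃ λ s → Through x y z (cellBlock F s)
    outside-cell b s d′ th′ on d th with switch F noFlip s d′ th′
    ... | (x₀ , y₀ , z₀) , th₀
      with refl ← unique b (tblock x₀ y₀ z₀) d′ on (through-≗ (sym ∘ tblock-cell x₀ y₀ z₀) th₀)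
      = switch noFlip F (x₀ , y₀ , z₀) d (through-≗ (tblock-cell x₀ y₀ z₀) th)

    block-closed : ∀ {x y z x′ y′ z′} → Distinct x y z → Distinct x′ y′ z′ →
      Through-image x′ y′ z′ (block x y z) → block x′ y′ z′ ≡ block x y z
    block-closed {x} {y} {z} {x′} {y′} {z′} d d′ on with block x y z | view d | block x′ y′ z′ | view d′
    ... | _ | inside s th | _ | inside s′ th′ =
      cong (image ∘ cellBlock F) (cellBlock-unique F s′ s d′ th′ (image-through⁻ on))
    ... | _ | inside s th | _ | outside b′ ∄s _ = contradiction (s , image-through⁻ on) ∄s
    ... | _ | outside b ∄s th | _ | inside s′ th′ =
      contradiction (outside-cell b s′ d′ th′ (image-through⁻ on) d th) ∄s
    ... | _ | outside b _ th | _ | outside b′ _ th′ with refl ← unique b′ b d′ th′ (image-through⁻ on) = refl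

    system : System v
    system = record { block = block ; size-4-6 = block-size ; contains = block-contains ; closed = block-closed }

    block-cell : ∀ s {x y z} → Distinct x y z → Through x y z (cellBlock F s) → block x y z ≡ image (cellBlock F s)
    block-cell s {x} {y} {z} d th with block x y z | view d
    ... | _ | inside s′ th′   = cong (image ∘ cellBlock F) (cellBlock-unique F s′ s d th′ th)
    ... | _ | outside b ∄s _ = contradiction (s , th) ∄s

  open Switched

  -- The block through points of the groups 0, 1 and 2 has just one point in group 3, and it names
  -- the symbol; subtracting `sum₃` leaves `Δ`.
  system-determines : ∀ F F′ → System.family (system F) ≡ System.family (system F′) →
    ∀ x y z → Flip.Δ F x y z ≡ Flip.Δ F′ x y z
  system-determines F F′ e x y z = begin
    Δ                          ≡⟨ ⊕-cancel Δ s ⟨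
    (Δ ⊕ s) ⊕ s                ≡⟨ cong (_⊕ s) (trans (⊕-comm Δ s) (trans L≡L′ (⊕-comm s Δ′))) ⟩
    (Δ′ ⊕ s) ⊕ s               ≡⟨ ⊕-cancel Δ′ s ⟩
    Δ′                         ∎
    where
    open ≡-Reasoning
    s  = sum₃ x y z
    Δ  = Flip.Δ F x y z
    Δ′ = Flip.Δ F′ x y z
    d : Distinct (point 0F x) (point 1F y) (point 2F z)
    d = (λ e → contradiction (cong proj₁ (point-inj e)) λ ()) , (λ e → contradiction (cong proj₁ (point-inj e)) λ ())
      , (λ e → contradiction (cong proj₁ (point-inj e)) λ ())
    on : ∀ F → Through (point 0F x) (point 1F y) (point 2F z) (cellBlock F (x , y , z))
    on F = (0F , refl) , (1F , refl) , (2F , refl)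
    images : image (cellBlock F (x , y , z)) ≡ image (cellBlock F′ (x , y , z))
    images = trans (sym (block-cell F (x , y , z) d (on F)))
      (trans (family-determines (system F) (system F′) e d) (block-cell F′ (x , y , z) d (on F′)))
    fourth : point 3F (L F x y z) ∈ᶠ cellBlock F′ (x , y , z)
    fourth = image⁻ (subst (point 3F (L F x y z) ∈ˢ_) images (image⁺ {g = cellBlock F (x , y , z)} (3F , refl)))
    L≡L′ : L F x y z ≡ L F′ x y z
    L≡L′ with fourth
    ... | i , e with refl ← cong proj₁ (point-inj e) = sym (cong proj₂ (point-inj e))

-- The lower bound and its constants

numDesigns-≥ : ∀ {v k} → Boolean (Fin v) (5 + k) → (9 * 2 ^ k) ^ ((2 ^ k) ^ 3) ≤ numDesigns v
numDesigns-≥ {v} {k} R = begin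
  (9 * 2 ^ k) ^ ((2 ^ k) ^ 3)        ≡⟨ cong ((9 * 2 ^ k) ^_) length-positions ⟨
  (9 * 2 ^ k) ^ length positions     ≤⟨ length-assignments positions ⟩
  length (assignments positions)     ≤⟨ matching-length Represents injective (assignments-unique positions)
                                          (λ f∈ → _ , System.family-∈ (systemOf f∈) , f∈ , refl) ⟩
  numDesigns v                       ∎
  where
  open ℕ.≤-Reasoning
  open Greedy k
  open Switch R
  flipOf : ∀ {f} → f ∈ assignments positions → Flip (5 + k)
  flipOf {f} f∈ = FlipOf.flip f (conflictfree positions positions-unique f∈)
  systemOf : ∀ {f} → f ∈ assignments positions → System v
  systemOf f∈ = Switched.system (flipOf f∈)
  Represents : List (Entry H) → List (Subset v) → Set
  Represents f B = Σ (f ∈ assignments positions) λ f∈ → B ≡ System.family (systemOf f∈)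
  injective : ∀ {f f′ B} → Represents f B → Represents f′ B → f ≡ f′
  injective {f} {f′} (f∈ , e) (f′∈ , e′) = flip-determines f f′
    (conflictfree positions positions-unique f∈) (conflictfree positions positions-unique f′∈)
    (trans (keys positions f∈) (sym (keys positions f′∈)))
    (system-determines (flipOf f∈) (flipOf f′∈) (trans (sym e) e′))

-- Here `c` is the number of cells, `N` a number of directions available at each, `D` the number of
-- designs. Passing from n to N costs a factor 4 in the exponent, passing from n³ to `c` a factor
-- `C`.
exponent-bound : ∀ {n N D c C} → 1 < N → 1 ≤ c → n ≤ N ^ 4 → n ^ 3 ≤ C * c → N ^ c ≤ D →
  n ^ (1 * n ^ 3) < D ^ suc (4 * C)
exponent-bound {n} {N} {D} {c} {C} 1<N 1≤c n≤ n³≤ ≤D = begin-strict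
  n ^ (1 * n ^ 3)          ≡⟨ cong (n ^_) (ℕ.*-identityˡ (n ^ 3)) ⟩
  n ^ (n ^ 3)              ≤⟨ ℕ.^-monoˡ-≤ (n ^ 3) n≤ ⟩
  (N ^ 4) ^ (n ^ 3)        ≡⟨ ℕ.^-*-assoc N 4 (n ^ 3) ⟩
  N ^ (4 * n ^ 3)          ≤⟨ ℕ.^-monoʳ-≤ N (ℕ.*-monoʳ-≤ 4 n³≤) ⟩
  -- Strictness comes from one more `c` in the exponent, hence `suc (4 * C)`.
  N ^ (4 * (C * c))        <⟨ ℕ.^-monoʳ-< N 1<N (ℕ.m<n+m _ 1≤c) ⟩
  N ^ (c + 4 * (C * c))    ≡⟨ cong (λ e → N ^ (c + e)) (trans (sym (ℕ.*-assoc 4 C c)) (ℕ.*-comm (4 * C) c)) ⟩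
  N ^ (c + c * (4 * C))    ≡⟨ cong (N ^_) (ℕ.*-suc c (4 * C)) ⟨
  N ^ (c * suc (4 * C))    ≡⟨ ℕ.^-*-assoc N c (suc (4 * C)) ⟨
  (N ^ c) ^ suc (4 * C)    ≤⟨ ℕ.^-monoˡ-≤ (suc (4 * C)) ≤D ⟩
  D ^ suc (4 * C)          ∎
  where
  open ℕ.≤-Reasoning
  instance
    N≢0 : NonZero N
    N≢0 = >-nonZero (ℕ.<⇒≤ 1<N)

^-distribʳ-* : ∀ m n k → (m * n) ^ k ≡ m ^ k * n ^ k
^-distribʳ-* m n zero    = refl
^-distribʳ-* m n (suc k) = trans (cong (m * n *_) (^-distribʳ-* m n k))
  (ℕ.[m*n]*[o*p]≡[m*o]*[n*p] m n (m ^ k) (n ^ k))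

-- For K < 5 one has n ≤ 6 · 2⁴ = 96. Five bits are required: a leading one to separate the vertices
-- of a subcube, and four for the index 16.
large-exponent : ∀ K {n} → 97 ≤ n → n ≤ 6 * 2 ^ K → 5 ≤ K
large-exponent K {n} 97≤n n≤ = ℕ.≮⇒≥ λ K<5 → ℕ.<⇒≱
  (ℕ.≤-<-trans (ℕ.≤-trans n≤ (ℕ.*-monoʳ-≤ 6 (ℕ.^-monoʳ-≤ 2 (ℕ.m<1+n⇒m≤n K<5)))) (ℕ.n<1+n 96)) 97≤n

numDesigns-large : ∀ n → 97 ≤ n → ∃ λ k → n ≤ 192 * 2 ^ k × (9 * 2 ^ k) ^ ((2 ^ k) ^ 3) ≤ numDesigns (2 * n)
numDesigns-large n 97≤n with booleanOrder n (ℕ.≤-trans (s≤s (s≤s (s≤s (s≤s z≤n)))) 97≤n)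
... | K , n≤ , R with ℕ.m≤n⇒∃[o]m+o≡n (large-exponent K 97≤n n≤)
... | k , refl = k , n≤192*2^k ,
      subst (λ v → (9 * 2 ^ k) ^ ((2 ^ k) ^ 3) ≤ numDesigns v) (ℕ.*-comm n 2) (numDesigns-≥ R)
  where
  open ℕ.≤-Reasoning
  n≤192*2^k : n ≤ 192 * 2 ^ k
  n≤192*2^k = begin
    n                ≤⟨ n≤ ⟩
    6 * 2 ^ (5 + k)  ≡⟨ cong (6 *_) (ℕ.^-distribˡ-+-* 2 5 k) ⟩
    6 * (32 * 2 ^ k) ≡⟨ ℕ.*-assoc 6 32 (2 ^ k) ⟨
    192 * 2 ^ k      ∎

base-bound : ∀ {n} k → n ≤ 192 * 2 ^ k → n ≤ (9 * 2 ^ k) ^ 4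
base-bound {n} k n≤ = begin
  n                     ≤⟨ n≤ ⟩
  -- The fourth power arises here: 9³ = 729 is the first power of 9 above 192, and one more factor
  -- supplies `a`.
  192 * a               ≤⟨ ℕ.*-mono-≤ (ℕ.≤ᵇ⇒≤ 192 729 _) (ℕ.m≤n*m a 9) ⟩
  9 ^ 3 * (9 * a)       ≤⟨ ℕ.*-monoˡ-≤ (9 * a) (ℕ.^-monoˡ-≤ 3 (ℕ.m≤m*n 9 a)) ⟩
  (9 * a) ^ 3 * (9 * a) ≡⟨ ℕ.*-comm ((9 * a) ^ 3) (9 * a) ⟩
  (9 * a) ^ 4           ∎
  where
  open ℕ.≤-Reasoning
  a = 2 ^ k
  instance
    a≢0 : NonZero a
    a≢0 = ℕ.m^n≢0 2 k

-- C stands for 192³; as a variable it keeps the power numDesigns (2 * n) ^ q from unfolding.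
many-designs : ∀ C → (∀ a → (192 * a) ^ 3 ≤ C * a ^ 3) → ∀ n → 97 ≤ n →
  n ^ (1 * n ^ 3) < numDesigns (2 * n) ^ suc (4 * C)
many-designs C ≤C n 97≤n =
  let k , n≤ , ≤D = numDesigns-large n 97≤n
      1<N = ℕ.≤-trans (s≤s (s≤s z≤n)) (ℕ.m≤m*n 9 (2 ^ k) ⦃ ℕ.m^n≢0 2 k ⦄)
  in exponent-bound {C = C} 1<N (ℕ.m^n>0 (2 ^ k) ⦃ ℕ.m^n≢0 2 k ⦄ 3) (base-bound k n≤)
       (ℕ.≤-trans (ℕ.^-monoˡ-≤ 3 n≤) (≤C (2 ^ k))) ≤D

constants : ∀ C → (∀ a → (192 * a) ^ 3 ≤ C * a ^ 3) → Σ ℕ λ p → Σ ℕ λ q → 1 ≤ p × 1 ≤ q × Σ ℕ λ N →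
  (n : ℕ) → N ≤ n → n ^ (p * n ^ 3) < numDesigns (2 * n) ^ q
constants C ≤C = 1 , suc (4 * C) , ℕ.≤-refl , s≤s z≤n , 97 , many-designs C ≤C

theorem4 : Σ ℕ λ p → Σ ℕ λ q → 1 ≤ p × 1 ≤ q × Σ ℕ λ N →
    (n : ℕ) → N ≤ n → n ^ (p * n ^ 3) < numDesigns (2 * n) ^ q
theorem4 = constants (192 ^ 3) (λ a → ℕ.≤-reflexive (^-distribʳ-* 192 a 3))
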